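{- For every $n\ge0$, $F_{RB}$ is a bijection from $\mathrm{PW}_n$ onto the set of bicolored-packed forests of weight $n$ and $T_{RB}$ is a bijection from the irreducible packed words of length $n$ onto the bicolored-packed trees of weight $n$; their inverses are $F_{RB}^*$, $T_{RB}^*$ defined by $F_{RB}^*([])=\varepsilon$, $F_{RB}^*([t_1,\dots,t_k])=T_{RB}^*(t_1)\odot\cdots\odot T_{RB}^*(t_k)$ and $T_{RB}^*(\mathrm{Node}(c,f_\ell,f_r))=F_{RB}^*(f_\ell)\triangleleft_R\big(F_{RB}^*(f_r)\triangleleft_B c\big)$. The same holds with $F_{BR}$, $T_{BR}$ in place of $F_{RB}$, $T_{RB}$: they are bijections between the same sets.
   Context: Words over positive integers; $|w|$ length, $\max(w)$ largest letter ($\max(\varepsilon)=0$), $w^{[k]}$ adds $k$ to all letters. Packed: all integers $1..\max(w)$ occur; $\mathrm{PW}_n$ packed words of length $n$. $u\odot v=u^{[\max(v)]}\cdot v$. Global descent of $w\in\mathrm{PW}_n$: $1\le c\le n-1$ with all of $w_1..w_c$ strictly greater than all of $w_{c+1}..w_n$; irreducible = nonempty, no global descent; each packed $w$ is uniquely $w_1\odot\cdots\odot w_k$ with irreducible $w_j$. Red operation: for $w\in\mathrm{PW}_n$, $I=\{i_1<\dots<i_p\}\subseteq\{1..n+p\}$, $p\ge1$, $\phi_I(w)$ has letter $\max(w)+1$ at the positions in $I$ and the letters of $w$ in order elsewhere; nonempty packed $v$ is uniquely $\phi_I(v')$, and $u\triangleleft_R v=\phi_{I+|u|}(u\odot v')$.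 Blue operation: $\psi_{i^\circ}(w)$ ($1\le i\le\max(w)+1$) adds $1$ to letters $\ge i$ and appends $i$; $\psi_{i^\bullet}(w)=w\cdot i$ ($1\le i\le\max(w)$); nonempty packed $v$ is uniquely $\psi_{i^\alpha}(v')$, and $u\triangleleft_B v=\psi_{(i+\max(u))^\alpha}(v'\odot u)$. For irreducible $w$, the red- (resp. blue-) factorization is the unique pair $(u,v)$, $v\ne\varepsilon$, with $w=u\triangleleft_R v$ (resp. $u\triangleleft_B v$) and $|u|$ maximal. A packed word is red-irreducible (resp. blue-irreducible) if it is irreducible and $w=u\triangleleft_R v$ (resp. $u\triangleleft_B v$) with $v\neq\varepsilon$ forces $u=\varepsilon$. The red-blue-factorization of irreducible $w$ is $w=a\triangleleft_R(b\triangleleft_B c)$ where $(a,x)$ is the red-factorization of $w$ and $(b,c)$ the blue-factorization of $x$; the blue-red-factorization is $w=b\triangleleft_B(a\triangleleft_R c)$ where $(b,y)$ is the blue-factorization of $w$ and $(a,c)$ the red-factorization of $y$. Biplane trees $\mathrm{Node}(x,f_\ell,f_r)$ with ordered possibly empty left/right forests; forests are ordered lists. Bicolored-packed trees are labeled by packed words: $\mathrm{Node}(z,f_\ell,f_r)$ is bicolored-packed if either ($z=1$, $f_r=[]$, all trees of $f_\ell$ bicolored-packed) or ($z\ne1$ is both red- and blue-irreducible and all trees of $f_\ell,f_r$ bicolored-packed). Weight = sum of lengths of all labels. $F_{RB}(\varepsilon)=F_{BR}(\varepsilon)=[]$; for $w=w_1\odot\cdots\odot w_k$ irreducible decomposition,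 $F_{RB}(w)=[T_{RB}(w_1),\dots,T_{RB}(w_k)]$ and $F_{BR}(w)=[T_{BR}(w_k),\dots,T_{BR}(w_1)]$; for irreducible $w$ with red-blue-factorization $a\triangleleft_R(b\triangleleft_B c)$, $T_{RB}(w)=\mathrm{Node}(c,F_{RB}(a),F_{RB}(b))$; with blue-red-factorization $b\triangleleft_B(a\triangleleft_R c)$, $T_{BR}(w)=\mathrm{Node}(c,F_{BR}(b),F_{BR}(a))$. -}

module Defs where

open import Data.Nat using (ℕ; zero; suc; _+_; _∸_; _≤_; _<_; _⊔_; _≡ᵇ_; _≤ᵇ_; _<ᵇ_)
open import Data.Bool using (Bool; true; false; if_then_else_)
open import Data.List using (List; []; _∷_; _++_; [_]; map; foldr; length; take; drop; filter; reverse)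
open import Data.Bool.ListAction using (any)
open import Data.Nat using (_≟_)
open import Relation.Nullary.Decidable using (¬?)
open import Data.List.Relation.Unary.All using (All)
open import Data.List.Membership.Propositional using (_∈_)
open import Data.Maybe using (Maybe; just; nothing)
open import Data.Product using (Σ; _×_; _,_)
open import Data.Sum using (_⊎_)
open import Relation.Nullary using (¬_)
open import Relation.Binary.PropositionalEquality using (_≡_; _≢_)

Word : Set
Word = List ℕ

maxW : Word → ℕ
maxW = foldr _⊔_ 0

shift : ℕ → Word → Word
shift k = map (k +_)

Packed : Word → Set
Packed w = All (1 ≤_) w × (∀ i → 1 ≤ i → i ≤ maxW w → i ∈ w)

_⊙_ : Word → Word → Word
u ⊙ v = shift (maxW v) u ++ v

infixr 6 _⊙_

⊙-all : List Word → Word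
⊙-all [] = []
⊙-all (x ∷ xs) = x ⊙ ⊙-all xs

GlobalDescent : Word → ℕ → Set
GlobalDescent w c =
  1 ≤ c × c < length w × All (λ x → All (λ y → y < x) (drop c w)) (take c w)

Irreducible : Word → Set
Irreducible w = Packed w × w ≢ [] × (∀ c → ¬ GlobalDescent w c)

memb : ℕ → List ℕ → Bool
memb j I = any (λ i → i ≡ᵇ j) I

-- φ_I(w): letter max(w)+1 at the positions (1-based) in I, letters of w in
-- order elsewhere; the result has length |w| + |I|.
φ : List ℕ → Word → Word
φ I w = go (length w + length I) 1 w
  where
  m = suc (maxW w)
  go : ℕ → ℕ → Word → Word
  go zero j v = []
  go (suc f) j v with memb j I
  ... | true = m ∷ go f (suc j) v
  go (suc f) j [] | false = []
  go (suc f) j (x ∷ v) | false = x ∷ go f (suc j) v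

positions : ℕ → Word → List ℕ
positions m w = go 1 w
  where
  go : ℕ → Word → List ℕ
  go j [] = []
  go j (x ∷ v) = if x ≡ᵇ m then j ∷ go (suc j) v else go (suc j) v

-- the unique (I , v') with v = φ_I(v') for nonempty packed v:
-- I = positions of max(v), v' = v with all letters max(v) erased
redI : Word → List ℕ
redI v = positions (maxW v) v

red' : Word → Word
red' v = filter (λ x → ¬? (x ≟ maxW v)) v

_◁R_ : Word → Word → Word
u ◁R v = φ (map (length u +_) (redI v)) (u ⊙ red' v)

ψ∘ : ℕ → Word → Word
ψ∘ i w = map (λ x → if i ≤ᵇ x then suc x else x) w ++ [ i ]

ψ• : ℕ → Word → Word
ψ• i w = w ++ [ i ]

splitLast : Word → Maybe (Word × ℕ)
splitLast [] = nothing
splitLast (x ∷ xs) with splitLast xs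
... | nothing = just ([] , x)
... | just (p , l) = just (x ∷ p , l)

-- u ◁B v = ψ_{(i+max u)^α}(v' ⊙ u) where v = ψ_{i^α}(v') is the unique
-- decomposition of the nonempty packed word v: i is the last letter of v;
-- α = • (v' = v without last letter) if i occurs earlier in v, otherwise
-- α = ∘ (v' = v without last letter, letters > i decreased by 1).
-- (For v = ε, which never occurs below, the value is irrelevant.)
_◁B_ : Word → Word → Word
u ◁B v with splitLast v
... | nothing = u
... | just (p , i) =
  if memb i p
  then ψ• (i + maxW u) (p ⊙ u)
  else ψ∘ (i + maxW u) (map (λ x → if i <ᵇ x then x ∸ 1 else x) p ⊙ u)

RedFact : Word → Word → Word → Set
RedFact w u v =
  Packed u × Packed v × v ≢ [] × w ≡ u ◁R v ×
  (∀ u' v' → Packed u' → Packed v' → v' ≢ [] → w ≡ u' ◁R v' → length u' ≤ length u)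

BlueFact : Word → Word → Word → Set
BlueFact w u v =
  Packed u × Packed v × v ≢ [] × w ≡ u ◁B v ×
  (∀ u' v' → Packed u' → Packed v' → v' ≢ [] → w ≡ u' ◁B v' → length u' ≤ length u)

RedIrreducible : Word → Set
RedIrreducible w =
  Irreducible w × (∀ u v → Packed u → Packed v → v ≢ [] → w ≡ u ◁R v → u ≡ [])

BlueIrreducible : Word → Set
BlueIrreducible w =
  Irreducible w × (∀ u v → Packed u → Packed v → v ≢ [] → w ≡ u ◁B v → u ≡ [])

data Tree : Set where
  Node : Word → List Tree → List Tree → Tree

Forest : Set
Forest = List Tree

mutual
  weightT : Tree → ℕ
  weightT (Node z fl fr) = length z + weightF fl + weightF fr

  weightF : Forest → ℕ
  weightF [] = 0
  weightF (t ∷ ts) = weightT t + weightF ts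

mutual
  data BPTree : Tree → Set where
    bp-one : ∀ {fl} → BPForest fl → BPTree (Node [ 1 ] fl [])
    bp-irr : ∀ {z fl fr} → z ≢ [ 1 ] → RedIrreducible z → BlueIrreducible z →
             BPForest fl → BPForest fr → BPTree (Node z fl fr)

  data BPForest : Forest → Set where
    [] : BPForest []
    _∷_ : ∀ {t ts} → BPTree t → BPForest ts → BPForest (t ∷ ts)

-- F_RB, T_RB, F_BR, T_BR as relations (graphs): F w f means "F(w) = f".
-- The paper defines them through unique decompositions/factorizations,
-- which we encode as these characterizing properties.

mutual
  data F-RB : Word → Forest → Set where
    f-rb : ∀ {w} ws {ts} → All Irreducible ws → w ≡ ⊙-all ws → T-RBs ws ts → F-RB w ts

  data T-RBs : List Word → Forest → Set where
    [] : T-RBs [] []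
    _∷_ : ∀ {w ws t ts} → T-RB w t → T-RBs ws ts → T-RBs (w ∷ ws) (t ∷ ts)

  data T-RB : Word → Tree → Set where
    t-rb : ∀ {w a x b c fa fb} → Irreducible w → RedFact w a x → BlueFact x b c →
           F-RB a fa → F-RB b fb → T-RB w (Node c fa fb)

mutual
  data F-BR : Word → Forest → Set where
    f-br : ∀ {w} ws {ts} → All Irreducible ws → w ≡ ⊙-all ws → T-BRs (reverse ws) ts → F-BR w ts

  data T-BRs : List Word → Forest → Set where
    [] : T-BRs [] []
    _∷_ : ∀ {w ws t ts} → T-BR w t → T-BRs ws ts → T-BRs (w ∷ ws) (t ∷ ts)

  data T-BR : Word → Tree → Set where
    t-br : ∀ {w b y a c fb fa} → Irreducible w → BlueFact w b y → RedFact y a c →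
           F-BR b fb → F-BR a fa → T-BR w (Node c fb fa)

mutual
  F*RB : Forest → Word
  F*RB [] = []
  F*RB (t ∷ ts) = T*RB t ⊙ F*RB ts

  T*RB : Tree → Word
  T*RB (Node c fl fr) = F*RB fl ◁R (F*RB fr ◁B c)

record IsBijection {A B : Set} (P : A → Set) (Q : B → Set) (R : A → B → Set) : Set where
  field
    total      : ∀ a → P a → Σ B (λ b → R a b)
    functional : ∀ a b b' → P a → R a b → R a b' → b ≡ b'
    into       : ∀ a b → P a → R a b → Q b
    injective  : ∀ a a' b → P a → P a' → R a b → R a' b → a ≡ a'
    surjective : ∀ b → Q b → Σ A (λ a → P a × R a b)

IsInverse : {A B : Set} (P : A → Set) (Q : B → Set) (R : A → B → Set) (inv : B → A) → Set
IsInverse {A} {B} P Q R inv =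
  (∀ a b → P a → R a b → inv b ≡ a) × (∀ b → Q b → P (inv b) × R (inv b) b)

PW : ℕ → Word → Set
PW n w = Packed w × length w ≡ n

IrrPW : ℕ → Word → Set
IrrPW n w = Irreducible w × length w ≡ n

BPF : ℕ → Forest → Set
BPF n f = BPForest f × weightF f ≡ n

BPT : ℕ → Tree → Set
BPT n t = BPTree t × weightT t ≡ n

{-# OPTIONS --safe #-}
module Submission where

-- Normal forms: if max v = k + 1, then u ◁R v is u^{[k]} followed by v with its maximal letters
-- raised by max u, and u ◁B (p·i) is p^{[max u]} · u · (i + max u).  From them one reads off that
-- both operations are actions of a monoid of packed words, u ◁R (u' ◁R v) = (u ⊙ u') ◁R v and
-- u ◁B (u' ◁B v) = (u' ⊙ u) ◁B v, which are cancellative: if u ◁ v = u' ◁ v' with |u| ≤ |u'|, then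
-- v = q ◁ v' for some packed q.  Hence (u , v) is a factorization of u ◁ v exactly when v is prime,
-- i.e. has only trivial factorizations.  The two actions commute, and b ◁B c = a ◁R x forces
-- x = b ◁B c' and c = a ◁R c' for a common c', except when c and x are both of the form
-- p · (max p + 1) = p ◁R 1 = p ◁B 1.  So red primality of b ◁B c amounts to that of c, apart from
-- the case c = 1, in which b must be empty; this is the condition defining bicolored-packed trees.
-- As moreover u ◁ v is irreducible exactly when v is, everything follows by induction on trees.

-- The two actions commute because they touch different parts of a word: red grafting writes in
-- front of `v` and changes only the largest letters of `v`, while blue grafting writes just before
-- the last letter and shifts all letters of `v` alike. The exception comes from the letter 1:
-- `u ◁R [ 1 ]` and `u ◁B [ 1 ]` are the same word, so a red and a blue factor need not split off
-- independently. Maximality among all factorizations is awkward to produce directly. Primality of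
-- the right factor is a local condition, and as lengths and letters are bounded it is decided by
-- search, so factorizations exist constructively. The induction on trees is carried out once, for
-- two abstract graftings, and the colours are then swapped.

open import Defs
open import Data.Bool using (Bool; true; false; if_then_else_; _∨_)
open import Data.Empty using (⊥-elim)
open import Data.List hiding (sum)
open import Data.List.Membership.DecPropositional using () renaming (_∈?_ to member?)
open import Data.List.Membership.Propositional using (_∈_; _∉_)
open import Data.List.Membership.Propositional.Properties
open import Data.List.Properties
open import Data.List.Relation.Binary.Permutation.Propositional using (_↭_; ↭-refl; ↭-sym; ↭-trans; ↭-reflexive)
open import Data.List.Relation.Binary.Permutation.Propositional.Properties using (All-resp-↭; map⁺; ↭-empty-inv; ↭-reverse; ∈-resp-↭; ↭-length) renaming (++⁺ˡ to ↭-++⁺ˡ; ++-comm to ↭-++-comm)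
open import Data.List.Relation.Binary.Pointwise using (Pointwise; []; _∷_)
open import Data.List.Relation.Unary.All as All using (All; []; _∷_)
import Data.List.Relation.Unary.All.Properties as All
open import Data.List.Relation.Unary.Any using (here; there)
open import Data.Maybe using (just)
open import Data.Nat
open import Data.Nat.Induction using (<-wellFounded)
open import Data.Nat.ListAction using (sum)
open import Data.Nat.ListAction.Properties using (sum-↭)
open import Data.Nat.Properties
open import Data.Product using (∃; _×_; _,_; proj₁; proj₂)
open import Data.Sum using (_⊎_; inj₁; inj₂)
open import Function using (_∘_; id; case_of_)
open import Induction.WellFounded using (Acc; acc)
open import Relation.Binary.Definitions using (tri<; tri≈; tri>)
open import Relation.Binary.PropositionalEquality hiding ([_])
open import Relation.Nullary using (¬_; Dec; yes; no)
open import Relation.Nullary.Decidable using (¬?; _×-dec_; _⊎-dec_; map′; dec-true; dec-false)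

-- Lists

cut : {A : Set} (xs ys xs' ys' : List A) → xs ++ ys ≡ xs' ++ ys' →
      length xs ≤ length xs' → ∃ λ q → xs' ≡ xs ++ q × ys ≡ q ++ ys'
cut [] ys xs' ys' e _ = xs' , refl , e
cut (x ∷ xs) ys (y ∷ xs') ys' e (s≤s l) with ∷-injective e
... | refl , e' with cut xs ys xs' ys' e' l
... | q , refl , e'' = q , refl , e''

map-split : {A B : Set} (f : A → B) (xs : List A) (ys : List B) {zs : List B} → map f xs ≡ ys ++ zs →
            ∃ λ xs₁ → ∃ λ xs₂ → xs ≡ xs₁ ++ xs₂ × map f xs₁ ≡ ys × map f xs₂ ≡ zs
map-split f xs [] e = [] , xs , refl , refl , e
map-split f (x ∷ xs) (y ∷ ys) e with ∷-injective e
... | refl , e' with map-split f xs ys e'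
... | xs₁ , xs₂ , refl , refl , refl = x ∷ xs₁ , xs₂ , refl , refl , refl

map-id-on : {A : Set} {f : A → A} (xs : List A) → (∀ {x} → x ∈ xs → f x ≡ x) → map f xs ≡ xs
map-id-on xs h = map-id-local (All.tabulate h)

map-injective-on : {A B : Set} {f : A → B} {P : A → Set} →
  (∀ {x y} → P x → P y → f x ≡ f y → x ≡ y) → ∀ xs ys →
  (∀ {x} → x ∈ xs → P x) → (∀ {x} → x ∈ ys → P x) → map f xs ≡ map f ys → xs ≡ ys
map-injective-on inj [] [] p q e = refl
map-injective-on inj (x ∷ xs) (y ∷ ys) p q e =
  cong₂ _∷_ (inj (p (here refl)) (q (here refl)) (∷-injectiveˡ e))
            (map-injective-on inj xs ys (p ∘ there) (q ∘ there) (∷-injectiveʳ e))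

length≡0⇒[] : {A : Set} {xs : List A} → length xs ≡ 0 → xs ≡ []
length≡0⇒[] {xs = []} _ = refl

≢[]⇒0<length : {A : Set} {xs : List A} → xs ≢ [] → 0 < length xs
≢[]⇒0<length {xs = []} n = ⊥-elim (n refl)
≢[]⇒0<length {xs = _ ∷ _} n = z<s

0<length⇒≢[] : {A : Set} {xs : List A} → 0 < length xs → xs ≢ []
0<length⇒≢[] p refl = n≮n 0 p

map-≢[] : {A B : Set} {f : A → B} {xs : List A} → xs ≢ [] → map f xs ≢ []
map-≢[] {xs = []} n _ = n refl

++-≢[]ʳ : {A : Set} (xs : List A) {ys : List A} → ys ≢ [] → xs ++ ys ≢ []
++-≢[]ʳ [] n = n

++-≢[]ˡ : {A : Set} {xs ys : List A} → xs ≢ [] → xs ++ ys ≢ []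
++-≢[]ˡ {xs = []} n _ = n refl

-- Words on the alphabet {1, …, m}

∈⇒≤maxW : ∀ {i w} → i ∈ w → i ≤ maxW w
∈⇒≤maxW {w = x ∷ w} (here refl) = m≤m⊔n x (maxW w)
∈⇒≤maxW {w = x ∷ w} (there p) = ≤-trans (∈⇒≤maxW p) (m≤n⊔m x (maxW w))

maxW-≤ : ∀ {m} w → (∀ {i} → i ∈ w → i ≤ m) → maxW w ≤ m
maxW-≤ [] h = z≤n
maxW-≤ (x ∷ w) h = ⊔-lub (h (here refl)) (maxW-≤ w (h ∘ there))

maxW∈ : ∀ {w} → w ≢ [] → maxW w ∈ w
maxW∈ {[]} n = ⊥-elim (n refl)
maxW∈ {x ∷ w} _ = go x w
  where
  go : ∀ x w → x ⊔ maxW w ∈ x ∷ w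
  go x [] = here (⊔-identityʳ x)
  go x (y ∷ w) with ⊔-sel x (maxW (y ∷ w))
  ... | inj₁ e = here e
  ... | inj₂ e = there (subst (_∈ y ∷ w) (sym e) (go y w))

-- Being packed, with the maximum as an explicit index that may be `suc k` or a sum; `Range⇒maxW`
-- recovers `maxW` afterwards.
Range : ℕ → Word → Set
Range m w = (∀ {i} → i ∈ w → 1 ≤ i × i ≤ m) × (∀ {i} → 1 ≤ i → i ≤ m → i ∈ w)

Packed⇒Range : ∀ {w} → Packed w → Range (maxW w) w
Packed⇒Range (pos , occ) = (λ p → All.lookup pos p , ∈⇒≤maxW p) , (λ {i} → occ i)

Range⇒maxW : ∀ {m w} → Range m w → maxW w ≡ m
Range⇒maxW {m} {w} (b , o) = ≤-antisym (maxW-≤ w (proj₂ ∘ b)) (lower m o)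
  where
  lower : ∀ m → (∀ {i} → 1 ≤ i → i ≤ m → i ∈ w) → m ≤ maxW w
  lower zero _ = z≤n
  lower (suc m) o = ∈⇒≤maxW (o (s≤s z≤n) ≤-refl)

Range⇒Packed : ∀ {m w} → Range m w → Packed w
Range⇒Packed {m} {w} r@(b , o) =
  All.tabulate (proj₁ ∘ b) , λ i l u → o l (≤-trans u (≤-reflexive (Range⇒maxW {m} {w} r)))

Packed⇒1≤ : ∀ {w i} → Packed w → i ∈ w → 1 ≤ i
Packed⇒1≤ p = proj₁ ∘ proj₁ (Packed⇒Range p)

Packed⇒1≤maxW : ∀ {w} → Packed w → w ≢ [] → 1 ≤ maxW w
Packed⇒1≤maxW p n = Packed⇒1≤ p (maxW∈ n)

Packed⇒1∈ : ∀ {w} → Packed w → w ≢ [] → 1 ∈ w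
Packed⇒1∈ p n = proj₂ (Packed⇒Range p) ≤-refl (Packed⇒1≤maxW p n)

Packed-[] : Packed []
Packed-[] = [] , λ i l u → ⊥-elim (n≮n 0 (≤-trans l u))

Packed-[1] : Packed [ 1 ]
Packed-[1] = Range⇒Packed {1} ((λ { (here refl) → ≤-refl , ≤-refl ; (there ()) }) , λ l u → here (≤-antisym u l))

Packed? : ∀ w → Dec (Packed w)
Packed? w = All.all? (1 ≤?_) w ×-dec
  map′ (λ { h (suc i) _ u → h u }) (λ h {i} l → h (suc i) (s≤s z≤n) l)
       (allUpTo? (λ i → member? _≟_ (suc i) w) (maxW w))

∈-shift⁻ : ∀ {k i} w → i ∈ shift k w → ∃ λ j → j ∈ w × i ≡ k + j
∈-shift⁻ w = ∈-map⁻ _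

∈-shift-cancel : ∀ {k j} w → k + j ∈ shift k w → j ∈ w
∈-shift-cancel {k} w p with ∈-shift⁻ w p
... | j , q , e = subst (_∈ w) (sym (+-cancelˡ-≡ k _ _ e)) q

shift-injective : ∀ k {u v} → shift k u ≡ shift k v → u ≡ v
shift-injective k = map-injective (+-cancelˡ-≡ k _ _)

shift-shift : ∀ k l w → shift k (shift l w) ≡ shift (k + l) w
shift-shift k l w = trans (sym (map-∘ w)) (map-cong (λ x → sym (+-assoc k l x)) w)

shift-0 : ∀ w → shift 0 w ≡ w
shift-0 = map-id

unshift : ∀ k w → (∀ {i} → i ∈ w → k ≤ i) → ∃ λ w' → w ≡ shift k w'
unshift k [] h = [] , refl
unshift k (x ∷ w) h with m≤n⇒∃[o]m+o≡n (h (here refl)) | unshift k w (h ∘ there)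
... | o , refl | w' , refl = o ∷ w' , refl

Range-⊙ : ∀ {m n u v} → Range m u → Range n v → Range (n + m) (shift n u ++ v)
Range-⊙ {m} {n} {u} {v} (bu , ou) (bv , ov) = b , o
  where
  b : ∀ {i} → i ∈ shift n u ++ v → 1 ≤ i × i ≤ n + m
  b p with ∈-++⁻ (shift n u) p
  ... | inj₂ q = proj₁ (bv q) , ≤-trans (proj₂ (bv q)) (m≤m+n n m)
  ... | inj₁ q with ∈-shift⁻ u q
  ... | j , r , refl = ≤-trans (proj₁ (bu r)) (m≤n+m j n) , +-monoʳ-≤ n (proj₂ (bu r))
  o : ∀ {i} → 1 ≤ i → i ≤ n + m → i ∈ shift n u ++ v
  o {i} l h with i ≤? n
  ... | yes i≤n = ∈-++⁺ʳ (shift n u) (ov l i≤n)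
  ... | no i≰n with m≤n⇒∃[o]m+o≡n (≰⇒> i≰n)
  ... | j , refl = ∈-++⁺ˡ (subst (_∈ shift n u) (+-suc n j)
          (∈-map⁺ (n +_) (ou (s≤s z≤n) (+-cancelˡ-≤ n _ _ (≤-trans (≤-reflexive (+-suc n j)) h)))))

⊙-Range : ∀ {u v} → Packed u → Packed v → Range (maxW v + maxW u) (u ⊙ v)
⊙-Range pu pv = Range-⊙ (Packed⇒Range pu) (Packed⇒Range pv)

⊙-Packed : ∀ {u v} → Packed u → Packed v → Packed (u ⊙ v)
⊙-Packed {u} {v} pu pv = Range⇒Packed (⊙-Range {u} {v} pu pv)

maxW-⊙ : ∀ {u v} → Packed u → Packed v → maxW (u ⊙ v) ≡ maxW v + maxW u
maxW-⊙ {u} {v} pu pv = Range⇒maxW (⊙-Range {u} {v} pu pv)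

length-⊙ : ∀ u v → length (u ⊙ v) ≡ length u + length v
length-⊙ u v = trans (length-++ (shift (maxW v) u)) (cong (_+ length v) (length-map _ u))

⊙-identityʳ : ∀ u → u ⊙ [] ≡ u
⊙-identityʳ u = trans (++-identityʳ _) (shift-0 u)

⊙-assoc : ∀ {u v w} → Packed v → Packed w → (u ⊙ v) ⊙ w ≡ u ⊙ (v ⊙ w)
⊙-assoc {u} {v} {w} pv pw = begin
  shift (maxW w) (shift (maxW v) u ++ v) ++ w
    ≡⟨ cong (_++ w) (map-++ _ (shift (maxW v) u) v) ⟩
  (shift (maxW w) (shift (maxW v) u) ++ shift (maxW w) v) ++ w
    ≡⟨ ++-assoc (shift (maxW w) (shift (maxW v) u)) _ w ⟩
  shift (maxW w) (shift (maxW v) u) ++ v ⊙ w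
    ≡⟨ cong (_++ v ⊙ w) (shift-shift (maxW w) (maxW v) u) ⟩
  shift (maxW w + maxW v) u ++ v ⊙ w
    ≡⟨ cong (λ k → shift k u ++ v ⊙ w) (maxW-⊙ {v} {w} pv pw) ⟨
  u ⊙ (v ⊙ w) ∎
  where open ≡-Reasoning

-- Irreducible words

-- Global descents are handled as splittings `s ++ t` instead of positions, since splittings can be
-- carried through `map` and `++`.
Above : Word → Word → Set
Above s t = ∀ {x y} → x ∈ s → y ∈ t → y < x

take-length-++ : {A : Set} (s t : List A) → take (length s) (s ++ t) ≡ s
take-length-++ [] t = refl
take-length-++ (x ∷ s) t = cong (x ∷_) (take-length-++ s t)

drop-length-++ : {A : Set} (s t : List A) → drop (length s) (s ++ t) ≡ t
drop-length-++ [] t = refl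
drop-length-++ (x ∷ s) t = drop-length-++ s t

Above⇒GlobalDescent : ∀ s t → s ≢ [] → t ≢ [] → Above s t → GlobalDescent (s ++ t) (length s)
Above⇒GlobalDescent s t ns nt a =
  ≢[]⇒0<length ns ,
  subst (length s <_) (sym (length-++ s)) (m<m+n (length s) (≢[]⇒0<length nt)) ,
  subst₂ (λ p q → All (λ x → All (_< x) p) q) (sym (drop-length-++ s t)) (sym (take-length-++ s t))
    (All.tabulate λ x∈s → All.tabulate λ y∈t → a x∈s y∈t)

GlobalDescent⇒Above : ∀ w c → GlobalDescent w c →
  take c w ≢ [] × drop c w ≢ [] × Above (take c w) (drop c w)
GlobalDescent⇒Above w c (l , h , a) =
  0<length⇒≢[] (subst (0 <_) (sym (length-take c w)) (⊓-glb l (≤-trans l (<⇒≤ h)))) ,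
  0<length⇒≢[] (subst (0 <_) (sym (length-drop c w)) (m<n⇒0<n∸m h)) ,
  λ x∈s y∈t → All.lookup (All.lookup a x∈s) y∈t

irreducible⇒¬Above : ∀ {w} → Irreducible w → ∀ s t → w ≡ s ++ t → s ≢ [] → t ≢ [] → ¬ Above s t
irreducible⇒¬Above (_ , _ , h) s t refl ns nt a = h (length s) (Above⇒GlobalDescent s t ns nt a)

¬Above⇒irreducible : ∀ {w} → Packed w → w ≢ [] →
  (∀ s t → w ≡ s ++ t → s ≢ [] → t ≢ [] → ¬ Above s t) → Irreducible w
¬Above⇒irreducible {w} p n h = p , n , λ c d →
  let ns , nt , a = GlobalDescent⇒Above w c d in
  h (take c w) (drop c w) (sym (take++drop≡id c w)) ns nt a

-- The letters of `t` lie below those of `s`, and together they fill an initial interval. So `t`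
-- fills the values up to `maxW t`, and `s` the ones after.
Above-split : ∀ {s t} → Packed (s ++ t) → t ≢ [] → Above s t →
  ∃ λ s' → Packed s' × Packed t × s ≡ shift (maxW t) s'
Above-split {s} {t} p nt a with unshift (maxW t) s (λ x∈s → <⇒≤ (a x∈s (maxW∈ nt)))
... | s' , refl = s' , Range⇒Packed {m} rs , Range⇒Packed rt , refl
  where
  n = maxW t
  w = shift n s' ++ t
  m = maxW w ∸ n
  n≤ : n ≤ maxW w
  n≤ = maxW-≤ t λ q → ∈⇒≤maxW (∈-++⁺ʳ (shift n s') q)
  rt : Range n t
  rt = (λ q → Packed⇒1≤ p (∈-++⁺ʳ (shift n s') q) , ∈⇒≤maxW q) , λ l u →
       case ∈-++⁻ (shift n s') (proj₂ p _ l (≤-trans u n≤)) of λ where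
         (inj₂ q) → q
         (inj₁ q) → ⊥-elim (<⇒≱ (a q (maxW∈ nt)) u)
  rs : Range m s'
  rs = (λ {i} q →
         let q' = ∈-map⁺ (n +_) q in
         +-cancelˡ-≤ n _ _ (≤-trans (≤-reflexive (+-comm n 1)) (a q' (maxW∈ nt))) ,
         +-cancelˡ-≤ n _ _ (≤-trans (∈⇒≤maxW {w = w} (∈-++⁺ˡ q')) (≤-reflexive (sym (m+[n∸m]≡n n≤))))) ,
       λ {i} l u →
         case ∈-++⁻ (shift n s') (proj₂ p (n + i) (≤-trans l (m≤n+m i n))
                (≤-trans (+-monoʳ-≤ n u) (≤-reflexive (m+[n∸m]≡n n≤)))) of λ where
           (inj₁ q) → ∈-shift-cancel s' q
           (inj₂ q) → ⊥-elim (<⇒≱ (≤-trans (≤-reflexive (+-comm 1 n)) (+-monoʳ-≤ n l)) (∈⇒≤maxW q))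

-- Unique decomposition into irreducible words

⊙-≢[] : ∀ {u v} → u ≢ [] → u ⊙ v ≢ []
⊙-≢[] n = ++-≢[]ˡ (map-≢[] n)

-- If `u'` reached beyond the copy of `u`, it would split into that copy and a piece of `v`. The
-- copy was shifted by `maxW v`, so this would be a global descent of `u'`.
⊙-injective-≤ : ∀ {u u' v v'} → Irreducible u → Irreducible u' →
  length u ≤ length u' → u ⊙ v ≡ u' ⊙ v' → u ≡ u' × v ≡ v'
⊙-injective-≤ {u} {u'} {v} {v'} iu iu' le e
  with cut (shift (maxW v) u) v (shift (maxW v') u') v' e (subst₂ _≤_ (sym (length-map _ u)) (sym (length-map _ u')) le)
... | [] , e₁ , refl = shift-injective (maxW v) (sym (trans e₁ (++-identityʳ _))) , refl
... | q@(_ ∷ _) , e₁ , refl with map-split _ u' (shift (maxW v) u) e₁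
... | u₁ , u₂ , refl , e₂ , e₃ = ⊥-elim (irreducible⇒¬Above iu' u₁ u₂ refl n₁ n₂ a)
  where
  n₁ : u₁ ≢ []
  n₁ refl = map-≢[] (proj₁ (proj₂ iu)) (sym e₂)
  n₂ : u₂ ≢ []
  n₂ refl = case e₃ of λ ()
  a : Above u₁ u₂
  a {x} {y} x∈ y∈ with ∈-shift⁻ u (subst (maxW v' + x ∈_) e₂ (∈-map⁺ _ x∈))
  ... | z , z∈ , ez = +-cancelˡ-< (maxW v') _ _ (≤-<-trans
          (∈⇒≤maxW {w = v} (∈-++⁺ˡ (subst (maxW v' + y ∈_) e₃ (∈-map⁺ _ y∈))))
          (subst (maxW v <_) (sym ez) (m<m+n (maxW v) (Packed⇒1≤ (proj₁ iu) z∈))))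

⊙-injective : ∀ {u u' v v'} → Irreducible u → Irreducible u' → u ⊙ v ≡ u' ⊙ v' → u ≡ u' × v ≡ v'
⊙-injective {u} {u'} {v} {v'} iu iu' e with ≤-total (length u) (length u')
... | inj₁ le = ⊙-injective-≤ iu iu' le e
... | inj₂ le = let e₁ , e₂ = ⊙-injective-≤ {v = v'} {v' = v} iu' iu le (sym e) in sym e₁ , sym e₂

⊙-all-injective : ∀ {ws ws'} → All Irreducible ws → All Irreducible ws' →
  ⊙-all ws ≡ ⊙-all ws' → ws ≡ ws'
⊙-all-injective [] [] e = refl
⊙-all-injective [] (i ∷ _) e = ⊥-elim (⊙-≢[] (proj₁ (proj₂ i)) (sym e))
⊙-all-injective (i ∷ _) [] e = ⊥-elim (⊙-≢[] (proj₁ (proj₂ i)) e)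
⊙-all-injective {w ∷ _} {w' ∷ _} (i ∷ is) (i' ∷ is') e with ⊙-injective {w} {w'} i i' e
... | e₁ , e₂ = cong₂ _∷_ e₁ (⊙-all-injective is is' e₂)

⊙-all-Packed : ∀ {ws} → All Irreducible ws → Packed (⊙-all ws)
⊙-all-Packed [] = Packed-[]
⊙-all-Packed {w ∷ ws} (i ∷ is) = ⊙-Packed {w} {⊙-all ws} (proj₁ i) (⊙-all-Packed is)

⊙-all-++ : ∀ {us vs} → All Irreducible us → All Irreducible vs → ⊙-all (us ++ vs) ≡ ⊙-all us ⊙ ⊙-all vs
⊙-all-++ [] ivs = refl
⊙-all-++ {u ∷ us} {vs} (_ ∷ ius) ivs = trans (cong (u ⊙_) (⊙-all-++ ius ivs))
  (sym (⊙-assoc {u} {⊙-all us} {⊙-all vs} (⊙-all-Packed ius) (⊙-all-Packed ivs)))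

GlobalDescent? : ∀ w c → Dec (GlobalDescent w c)
GlobalDescent? w c = (1 ≤? c) ×-dec (c <? length w) ×-dec
  All.all? (λ x → All.all? (_<? x) (drop c w)) (take c w)

irreducible-or-split : ∀ {w} → Packed w → w ≢ [] → Irreducible w ⊎
  (∃ λ u → ∃ λ v → Packed u × Packed v × u ≢ [] × v ≢ [] × w ≡ u ⊙ v)
irreducible-or-split {w} p n with anyUpTo? (GlobalDescent? w) (length w)
... | no h = inj₁ (p , n , λ c d → h (c , proj₁ (proj₂ d) , d))
... | yes (c , _ , d) with GlobalDescent⇒Above w c d
... | ns , nt , a with Above-split {take c w} {drop c w} (subst Packed (sym (take++drop≡id c w)) p) nt a
... | s' , ps , pt , e = inj₂ (s' , drop c w , ps , pt , (λ { refl → ns e }) , nt ,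
        trans (sym (take++drop≡id c w)) (cong (_++ drop c w) e))

decompose : ∀ w → Packed w → ∃ λ ws → All Irreducible ws × w ≡ ⊙-all ws
decompose w = go w (<-wellFounded _)
  where
  go : ∀ w → Acc _<_ (length w) → Packed w → ∃ λ ws → All Irreducible ws × w ≡ ⊙-all ws
  go [] _ p = [] , [] , refl
  go w@(_ ∷ _) (acc rec) p with irreducible-or-split p (λ ())
  ... | inj₁ i = [ w ] , i ∷ [] , sym (⊙-identityʳ w)
  ... | inj₂ (u , v , pu , pv , nu , nv , e)
    with go u (rec (subst (length u <_) (sym (trans (cong length e) (length-⊙ u v)))
                 (m<m+n (length u) (≢[]⇒0<length nv)))) pu
       | go v (rec (subst (length v <_) (sym (trans (cong length e) (length-⊙ u v)))
                 (m<n+m (length v) (≢[]⇒0<length nu)))) pv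
  ... | us , ius , eu | vs , ivs , ev =
    us ++ vs , All.++⁺ ius ivs , trans e (trans (cong₂ _⊙_ eu ev) (sym (⊙-all-++ ius ivs)))

-- Factorizations

Prime : (Word → Word → Word) → Word → Set
Prime _◁_ w = ∀ u v → Packed u → Packed v → v ≢ [] → w ≡ u ◁ v → u ≡ []

-- RedFact and BlueFact unfold to the instances of this at _◁R_ and _◁B_.
Factorization : (Word → Word → Word) → Word → Word → Word → Set
Factorization _◁_ w u v =
  Packed u × Packed v × v ≢ [] × w ≡ u ◁ v ×
  (∀ u' v' → Packed u' → Packed v' → v' ≢ [] → w ≡ u' ◁ v' → length u' ≤ length u)

-- Exhaustive search over finitely many words. It decides whether a word has a nontrivial
-- factorization, which replaces excluded middle in `factorize`.
anyWord? : ∀ n m {P : Word → Set} → (∀ w → Dec (P w)) →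
  Dec (∃ λ w → length w ≤ n × All (_≤ m) w × P w)
anyWord? zero m P? = map′ (λ p → [] , z≤n , [] , p) (λ { ([] , _ , _ , p) → p }) (P? [])
anyWord? (suc n) m P? =
  map′ (λ { (inj₁ p) → [] , z≤n , [] , p
          ; (inj₂ (x , x< , w , l , b , p)) → x ∷ w , s≤s l , s≤s⁻¹ x< ∷ b , p })
       (λ { ([] , _ , _ , p) → inj₁ p
          ; (x ∷ w , s≤s l , b ∷ bs , p) → inj₂ (x , s≤s b , w , l , bs , p) })
       (P? [] ⊎-dec anyUpTo? (λ x → anyWord? n m (λ w → P? (x ∷ w))) (suc m))

_≟W_ : (u v : Word) → Dec (u ≡ v)
_≟W_ = ≡-dec _≟_

-- `_·_` is `_⊙_` for red and its opposite for blue. The right-hand side of `◁-[1]` does not mention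
-- `_◁_`: any two graftings agree on `[ 1 ]`, which is the source of the special role of the label 1
-- in bicolored-packed trees.
record Grafting (_◁_ : Word → Word → Word) : Set where
  field
    _·_ : Word → Word → Word
    ·-Packed : ∀ {u v} → Packed u → Packed v → Packed (u · v)
    length-· : ∀ u v → length (u · v) ≡ length u + length v
    ·-identityʳ : ∀ u → u · [] ≡ u
    ◁-identityˡ : ∀ {v} → Packed v → v ≢ [] → [] ◁ v ≡ v
    ◁-Range : ∀ {u v} → Packed u → Packed v → v ≢ [] → Range (maxW u + maxW v) (u ◁ v)
    length-◁ : ∀ {u v} → Packed u → Packed v → v ≢ [] → length (u ◁ v) ≡ length u + length v
    ◁-assoc : ∀ {u v w} → Packed u → Packed v → Packed w → w ≢ [] → u ◁ (v ◁ w) ≡ (u · v) ◁ w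
    ◁-cancel : ∀ {u v u' v'} → Packed u → Packed v → v ≢ [] → Packed u' → Packed v' → v' ≢ [] →
      length u ≤ length u' → u ◁ v ≡ u' ◁ v' → ∃ λ q → Packed q × u' ≡ u · q × v ≡ q ◁ v'
    ◁-irreducible : ∀ {u v} → Packed u → Irreducible v → Irreducible (u ◁ v)
    ◁-irreducible⁻ : ∀ {u v} → Packed u → Packed v → v ≢ [] → Irreducible (u ◁ v) → Irreducible v
    ◁-[1] : ∀ {u} → Packed u → u ◁ [ 1 ] ≡ u ++ [ suc (maxW u) ]

  ◁-Packed : ∀ {u v} → Packed u → Packed v → v ≢ [] → Packed (u ◁ v)
  ◁-Packed pu pv nv = Range⇒Packed (◁-Range pu pv nv)

  maxW-◁ : ∀ {u v} → Packed u → Packed v → v ≢ [] → maxW (u ◁ v) ≡ maxW u + maxW v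
  maxW-◁ pu pv nv = Range⇒maxW (◁-Range pu pv nv)

  length-<-◁ : ∀ {u v} → Packed u → Packed v → v ≢ [] → length u < length (u ◁ v)
  length-<-◁ {u} pu pv nv = subst (length u <_) (sym (length-◁ pu pv nv)) (m<m+n (length u) (≢[]⇒0<length nv))

  ◁-≢[] : ∀ {u v} → Packed u → Packed v → v ≢ [] → u ◁ v ≢ []
  ◁-≢[] pu pv nv = 0<length⇒≢[] (≤-<-trans z≤n (length-<-◁ pu pv nv))

  ·-length-≤⇒[] : ∀ u {v} → length (u · v) ≤ length u → v ≡ []
  ·-length-≤⇒[] u {v} le = length≡0⇒[] (n≤0⇒n≡0 (+-cancelˡ-≤ (length u) _ _
    (subst₂ _≤_ (length-· u v) (sym (+-identityʳ _)) le)))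

  ◁-injective : ∀ {u v u' v'} → Packed u → Packed v → v ≢ [] → Packed u' → Packed v' → v' ≢ [] →
    length u ≡ length u' → u ◁ v ≡ u' ◁ v' → u ≡ u' × v ≡ v'
  ◁-injective {u} {v} {u'} {v'} pu pv nv pu' pv' nv' le e
    with ◁-cancel pu pv nv pu' pv' nv' (≤-reflexive le) e
  ... | q , _ , e₁ , e₂ with ·-length-≤⇒[] u {q} (≤-reflexive (trans (cong length (sym e₁)) (sym le)))
  ... | refl = sym (trans e₁ (·-identityʳ u)) , trans e₂ (◁-identityˡ pv' nv')

  prime-[1] : Prime _◁_ [ 1 ]
  prime-[1] u v pu pv nv e = length≡0⇒[]
    (n≤0⇒n≡0 (s≤s⁻¹ (subst (length u <_) (cong length (sym e)) (length-<-◁ pu pv nv))))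

  -- Splitting `v` further as `u' ◁ v'` gives `w` the left factor `u · u'`, and maximality of `u`
  -- leaves no room for `u'`.
  factor⇒prime : ∀ {w u v} → Factorization _◁_ w u v → Prime _◁_ v
  factor⇒prime {u = u} (pu , pv , nv , e , mx) u' v' pu' pv' nv' refl =
    ·-length-≤⇒[] u (mx (u · u') v' (·-Packed pu pu') pv' nv' (trans e (◁-assoc pu pu' pv' nv')))

  -- A competing left factor at least as long as `u` is, by cancellation, `u · q` with `v ≡ q ◁ v'`,
  -- and primality empties `q`.
  prime⇒factor : ∀ {u v} → Packed u → Packed v → v ≢ [] → Prime _◁_ v → Factorization _◁_ (u ◁ v) u v
  prime⇒factor {u} {v} pu pv nv prime = pu , pv , nv , refl , λ u' v' pu' pv' nv' e →
    case ≤-total (length u') (length u) of λ where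
      (inj₁ le) → le
      (inj₂ ge) → case ◁-cancel pu pv nv pu' pv' nv' ge e of λ where
        (q , pq , e₁ , e₂) → case prime q v' pq pv' nv' e₂ of λ where
          refl → ≤-reflexive (cong length (trans e₁ (·-identityʳ u)))

  factor-unique : ∀ {w u v u' v'} → Factorization _◁_ w u v → Factorization _◁_ w u' v' → u ≡ u' × v ≡ v'
  factor-unique (pu , pv , nv , e , mx) (pu' , pv' , nv' , e' , mx') =
    ◁-injective pu pv nv pu' pv' nv' (≤-antisym (mx' _ _ pu pv nv e) (mx _ _ pu' pv' nv' e'))
      (trans (sym e) e')

  Splits : Word → Word → Word → Set
  Splits w u v = Packed u × Packed v × u ≢ [] × v ≢ [] × w ≡ u ◁ v

  -- Length and maximum are additive under `_◁_`, which bounds the search for both factors.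
  splits? : ∀ w → Dec (∃ λ u → ∃ λ v → Splits w u v)
  splits? w = map′ (λ (u , _ , _ , v , _ , _ , s) → u , v , s) bound
    (anyWord? n m λ u → anyWord? n m λ v →
      Packed? u ×-dec Packed? v ×-dec ¬? (u ≟W []) ×-dec ¬? (v ≟W []) ×-dec (w ≟W (u ◁ v)))
    where
    n = length w
    m = maxW w
    bound : (∃ λ u → ∃ λ v → Splits w u v) →
      ∃ λ u → length u ≤ n × All (_≤ m) u × ∃ λ v → length v ≤ n × All (_≤ m) v × Splits w u v
    bound (u , v , s@(pu , pv , nu , nv , e)) =
      u , subst (length u ≤_) (sym ln) (m≤m+n (length u) (length v)) ,
      All.tabulate (λ i → ≤-trans (∈⇒≤maxW i) (subst (maxW u ≤_) (sym mx) (m≤m+n (maxW u) (maxW v)))) ,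
      v , subst (length v ≤_) (sym ln) (m≤n+m (length v) (length u)) ,
      All.tabulate (λ i → ≤-trans (∈⇒≤maxW i) (subst (maxW v ≤_) (sym mx) (m≤n+m (maxW v) (maxW u)))) ,
      s
      where
      ln = trans (cong length e) (length-◁ pu pv nv)
      mx = trans (cong maxW e) (maxW-◁ pu pv nv)

  -- Nonempty left factors are split off until the right factor is prime, and are collected by
  -- associativity; `prime⇒factor` then supplies maximality.
  factorize : ∀ w → Packed w → w ≢ [] → ∃ λ u → ∃ λ v → Factorization _◁_ w u v
  factorize w pw nw with go w (<-wellFounded _) pw nw
    where
    go : ∀ w → Acc _<_ (length w) → Packed w → w ≢ [] →
      ∃ λ u → ∃ λ v → Packed u × Packed v × v ≢ [] × Prime _◁_ v × w ≡ u ◁ v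
    go w (acc rec) pw nw with splits? w
    ... | no h = [] , w , Packed-[] , pw , nw , prime , sym (◁-identityˡ pw nw)
      where
      prime : Prime _◁_ w
      prime [] v pu pv nv e = refl
      prime u@(_ ∷ _) v pu pv nv e = ⊥-elim (h (u , v , pu , pv , (λ ()) , nv , e))
    ... | yes (u , v , pu , pv , nu , nv , e)
      with go v (rec (subst (length v <_) (sym (trans (cong length e) (length-◁ pu pv nv)))
                   (m<n+m (length v) (≢[]⇒0<length nu)))) pv nv
    ... | u' , v' , pu' , pv' , nv' , prime , refl =
      u · u' , v' , ·-Packed pu pu' , pv' , nv' , prime , trans e (◁-assoc pu pu' pv' nv')
  ... | u , v , pu , pv , nv , prime , refl = u , v , prime⇒factor pu pv nv prime

-- Trees

length-⊙-all : ∀ ws → length (⊙-all ws) ≡ sum (map length ws)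
length-⊙-all [] = refl
length-⊙-all (w ∷ ws) = trans (length-⊙ w (⊙-all ws)) (cong (length w +_) (length-⊙-all ws))

-- ord is the identity for the red-blue trees and list reversal for the blue-red ones.
module TreeBijection
  {_◁₁_ _◁₂_ : Word → Word → Word} (G₁ : Grafting _◁₁_) (G₂ : Grafting _◁₂_)
  (commute : ∀ {a b c} → Packed a → Packed b → Packed c → c ≢ [] → a ◁₁ (b ◁₂ c) ≡ b ◁₂ (a ◁₁ c))
  -- Of the second case only the shape of `c` is kept: it is `p ◁₁ [ 1 ]`, which is decisive once
  -- `c` is prime.
  (exchange : ∀ {a b c x} → Packed a → Packed b → Packed c → c ≢ [] → Packed x → x ≢ [] →
    b ◁₂ c ≡ a ◁₁ x →
    (∃ λ c' → Packed c' × c' ≢ [] × c ≡ a ◁₁ c') ⊎ (∃ λ p → Packed p × c ≡ p ++ [ suc (maxW p) ]))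
  (ord : List Word → List Word)
  (ord-↭ : ∀ ws → ord ws ↭ ws)
  (ord-involutive : ∀ ws → ord (ord ws) ≡ ws)
  (node⁺ : ∀ {c fl fr} → Irreducible c → Prime _◁₁_ c → Prime _◁₂_ c → (c ≡ [ 1 ] → fr ≡ []) →
    BPForest fl → BPForest fr → BPTree (Node c fl fr))
  (node⁻ : ∀ {c fl fr} → BPTree (Node c fl fr) →
    Irreducible c × Prime _◁₁_ c × Prime _◁₂_ c × (c ≡ [ 1 ] → fr ≡ []) × BPForest fl × BPForest fr)
  -- The graphs of the two maps are different data types, so they enter only through rules for
  -- building and for taking apart.
  (F : Word → Forest → Set) (T : Word → Tree → Set)
  (F⁺ : ∀ ws {f} → All Irreducible ws → Pointwise T (ord ws) f → F (⊙-all ws) f)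
  (F⁻ : ∀ {w f} → F w f → ∃ λ ws → All Irreducible ws × w ≡ ⊙-all ws × Pointwise T (ord ws) f)
  (T⁺ : ∀ {w a x b c fl fr} → Irreducible w → Factorization _◁₁_ w a x → Factorization _◁₂_ x b c →
    F a fl → F b fr → T w (Node c fl fr))
  (T⁻ : ∀ {w c fl fr} → T w (Node c fl fr) → ∃ λ a → ∃ λ x → ∃ λ b →
    Irreducible w × Factorization _◁₁_ w a x × Factorization _◁₂_ x b c × F a fl × F b fr)
  where

  private
    module G₁ = Grafting G₁
    module G₂ = Grafting G₂

  ord-All : ∀ {P : Word → Set} {ws} → All P ws → All P (ord ws)
  ord-All = All-resp-↭ (↭-sym (ord-↭ _))

  ord-[] : ord [] ≡ []
  ord-[] = ↭-empty-inv (ord-↭ [])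

  length-⊙-all-ord : ∀ ws → length (⊙-all ws) ≡ sum (map length (ord ws))
  length-⊙-all-ord ws = trans (length-⊙-all ws) (sum-↭ (map⁺ length (↭-sym (ord-↭ ws))))

  -- By commutation, a left factor of `c` for `_◁₁_` is one of `x`, which is prime. If `c` is
  -- `[ 1 ]`, then `x` is also `b ◁₁ [ 1 ]`, and the same primality gives `b ≡ []`.
  node-label : ∀ {w a x b c} → Irreducible w → Factorization _◁₁_ w a x → Factorization _◁₂_ x b c →
    Irreducible c × Prime _◁₁_ c × Prime _◁₂_ c × (c ≡ [ 1 ] → b ≡ [])
  node-label {b = b} {c} iw f₁@(pa , px , nx , refl , _) f₂@(pb , pc , nc , refl , _) =
    G₂.◁-irreducible⁻ pb pc nc (G₁.◁-irreducible⁻ pa px nx iw) , prime₁ , G₂.factor⇒prime f₂ ,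
    λ { refl → G₁.factor⇒prime f₁ b [ 1 ] pb Packed-[1] (λ ())
               (trans (G₂.◁-[1] pb) (sym (G₁.◁-[1] pb))) }
    where
    prime₁ : Prime _◁₁_ c
    prime₁ u v pu pv nv refl = G₁.factor⇒prime f₁ u (b ◁₂ v) pu (G₂.◁-Packed pb pv nv) (G₂.◁-≢[] pb pv nv)
      (sym (commute pu pb pv nv))

  -- In the exceptional case of the exchange `c` is `p ◁₁ [ 1 ]`. Primality empties `p`, so `c` is
  -- `[ 1 ]`; the hypothesis then empties `b`, and grafting `b` changes nothing.
  prime-graft : ∀ {b c} → Packed b → Packed c → c ≢ [] → Prime _◁₁_ c → (c ≡ [ 1 ] → b ≡ []) →
    Prime _◁₁_ (b ◁₂ c)
  prime-graft {b} {c} pb pc nc prime one a x pa px nx e with exchange pa pb pc nc px nx e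
  ... | inj₁ (c' , pc' , nc' , e') = prime a c' pa pc' nc' e'
  ... | inj₂ (p , pp , e') with prime p [ 1 ] pp Packed-[1] (λ ()) (trans e' (sym (G₁.◁-[1] pp)))
  ... | refl with one e'
  ... | refl = prime a x pa px nx (trans (sym (G₂.◁-identityˡ pc nc)) e)

  F-Packed : ∀ {w f} → F w f → Packed w
  F-Packed Fw with F⁻ Fw
  ... | ws , iws , refl , _ = ⊙-all-Packed iws

  F-[] : ∀ {f} → F [] f → f ≡ []
  F-[] Fw with F⁻ Fw
  ... | ws , iws , e , ts with ⊙-all-injective [] iws e
  ... | refl with subst (λ us → Pointwise T us _) ord-[] ts
  ... | [] = refl

  mutual
    T* : Tree → Word
    T* (Node c fl fr) = F* fl ◁₁ (F* fr ◁₂ c)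

    Ts* : Forest → List Word
    Ts* [] = []
    Ts* (t ∷ f) = T* t ∷ Ts* f

    -- `ord` permutes the list of components as a whole, so all trees become words before they are
    -- multiplied. For the identity this agrees with `F*RB` by `F*RB≗`.
    F* : Forest → Word
    F* f = ⊙-all (ord (Ts* f))

  mutual
    T*-inverseˡ : ∀ t {w} → T w t → T* t ≡ w
    T*-inverseˡ (Node c fl fr) Tw with T⁻ Tw
    ... | a , x , b , _ , (_ , _ , _ , e₁ , _) , (_ , _ , _ , e₂ , _) , Fa , Fb = sym (trans e₁
      (cong₂ _◁₁_ (sym (F*-inverseˡ fl Fa)) (trans e₂ (cong (_◁₂ c) (sym (F*-inverseˡ fr Fb))))))

    Ts*-inverseˡ : ∀ f {ws} → Pointwise T ws f → Ts* f ≡ ws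
    Ts*-inverseˡ [] [] = refl
    Ts*-inverseˡ (t ∷ f) (Tw ∷ Tws) = cong₂ _∷_ (T*-inverseˡ t Tw) (Ts*-inverseˡ f Tws)

    F*-inverseˡ : ∀ f {w} → F w f → F* f ≡ w
    F*-inverseˡ f Fw with F⁻ Fw
    ... | ws , _ , refl , Tws = cong ⊙-all (trans (cong ord (Ts*-inverseˡ f Tws)) (ord-involutive ws))

  mutual
    T-weight : ∀ t {w} → T w t → weightT t ≡ length w
    T-weight (Node c fl fr) Tw with T⁻ Tw
    ... | a , x , b , _ , (pa , px , nx , refl , _) , (pb , pc , nc , refl , _) , Fa , Fb = begin
      length c + weightF fl + weightF fr     ≡⟨ cong₂ (λ i j → length c + i + j) (F-weight fl Fa) (F-weight fr Fb) ⟩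
      length c + length a + length b         ≡⟨ cong (_+ length b) (+-comm (length c) (length a)) ⟩
      length a + length c + length b         ≡⟨ +-assoc (length a) _ _ ⟩
      length a + (length c + length b)       ≡⟨ cong (length a +_) (+-comm (length c) (length b)) ⟩
      length a + (length b + length c)       ≡⟨ cong (length a +_) (G₂.length-◁ pb pc nc) ⟨
      length a + length (b ◁₂ c)             ≡⟨ G₁.length-◁ pa px nx ⟨
      length (a ◁₁ (b ◁₂ c))                 ∎
      where open ≡-Reasoning

    Ts-weight : ∀ f {ws} → Pointwise T ws f → weightF f ≡ sum (map length ws)
    Ts-weight [] [] = refl
    Ts-weight (t ∷ f) (Tw ∷ Tws) = cong₂ _+_ (T-weight t Tw) (Ts-weight f Tws)

    F-weight : ∀ f {w} → F w f → weightF f ≡ length w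
    F-weight f Fw with F⁻ Fw
    ... | ws , _ , refl , Tws = trans (Ts-weight f Tws) (sym (length-⊙-all-ord ws))

  mutual
    T-bicolored : ∀ t {w} → T w t → BPTree t
    T-bicolored (Node c fl fr) Tw with T⁻ Tw
    ... | a , x , b , iw , f₁ , f₂ , Fa , Fb with node-label iw f₁ f₂
    ... | ic , p₁ , p₂ , one = node⁺ ic p₁ p₂ (λ e → F-[] (subst (λ b → F b fr) (one e) Fb))
      (F-bicolored fl Fa) (F-bicolored fr Fb)

    Ts-bicolored : ∀ f {ws} → Pointwise T ws f → BPForest f
    Ts-bicolored [] [] = []
    Ts-bicolored (t ∷ f) (Tw ∷ Tws) = T-bicolored t Tw ∷ Ts-bicolored f Tws

    F-bicolored : ∀ f {w} → F w f → BPForest f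
    F-bicolored f Fw = Ts-bicolored f (proj₂ (proj₂ (proj₂ (F⁻ Fw))))

  mutual
    -- The label is prime for `_◁₂_`, and `prime-graft` makes `F* fr ◁₂ c` prime for `_◁₁_`; so the
    -- nested graftings in `T*` are the factorizations required by `T⁺`.
    T*-inverseʳ : ∀ t → BPTree t → Irreducible (T* t) × T (T* t) t
    T*-inverseʳ (Node c fl fr) bt with node⁻ bt
    ... | ic@(pc , nc , _) , p₁ , p₂ , one , bl , br = irr , T⁺ irr
        (G₁.prime⇒factor (F-Packed Fa) (G₂.◁-Packed (F-Packed Fb) pc nc) (G₂.◁-≢[] (F-Packed Fb) pc nc)
          (prime-graft (F-Packed Fb) pc nc p₁ λ e → trans (cong F* (one e)) (cong ⊙-all ord-[])))
        (G₂.prime⇒factor (F-Packed Fb) pc nc p₂)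
        Fa Fb
      where
      Fa = F*-inverseʳ fl bl
      Fb = F*-inverseʳ fr br
      irr = G₁.◁-irreducible (F-Packed Fa) (G₂.◁-irreducible (F-Packed Fb) ic)

    Ts*-inverseʳ : ∀ f → BPForest f → All Irreducible (Ts* f) × Pointwise T (Ts* f) f
    Ts*-inverseʳ [] [] = [] , []
    Ts*-inverseʳ (t ∷ f) (bt ∷ bf) with T*-inverseʳ t bt | Ts*-inverseʳ f bf
    ... | i , Tw | is , Tws = i ∷ is , Tw ∷ Tws

    F*-inverseʳ : ∀ f → BPForest f → F (F* f) f
    F*-inverseʳ f bf with Ts*-inverseʳ f bf
    ... | is , Tws = F⁺ (ord (Ts* f)) (ord-All is)
      (subst (λ us → Pointwise T us f) (sym (ord-involutive (Ts* f))) Tws)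

  mutual
    T-functional : ∀ t t' {w} → T w t → T w t' → t ≡ t'
    T-functional (Node c fl fr) (Node c' fl' fr') Tw Tw' with T⁻ Tw | T⁻ Tw'
    ... | a , x , b , _ , f₁ , f₂ , Fa , Fb | a' , x' , b' , _ , f₁' , f₂' , Fa' , Fb'
      with G₁.factor-unique f₁ f₁'
    ... | refl , refl with G₂.factor-unique f₂ f₂'
    ... | refl , refl = cong₂ (Node c) (F-functional fl fl' Fa Fa') (F-functional fr fr' Fb Fb')

    Ts-functional : ∀ f f' {ws} → Pointwise T ws f → Pointwise T ws f' → f ≡ f'
    Ts-functional [] [] [] [] = refl
    Ts-functional (t ∷ f) (t' ∷ f') (Tw ∷ Tws) (Tw' ∷ Tws') =
      cong₂ _∷_ (T-functional t t' Tw Tw') (Ts-functional f f' Tws Tws')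

    F-functional : ∀ f f' {w} → F w f → F w f' → f ≡ f'
    F-functional f f' Fw Fw' with F⁻ Fw | F⁻ Fw'
    ... | ws , iws , refl , Tws | ws' , iws' , e , Tws' with ⊙-all-injective iws iws' e
    ... | refl = Ts-functional f f' Tws Tws'

  mutual
    -- The bound drops only from a tree to its two forests, whose words are strictly shorter than
    -- `w`. A forest passes it on unchanged, since it may consist of a single tree.
    T-total-≤ : ∀ n w → length w ≤ n → Irreducible w → ∃ λ t → T w t
    T-total-≤ zero w le (_ , nw , _) = ⊥-elim (nw (length≡0⇒[] (n≤0⇒n≡0 le)))
    T-total-≤ (suc n) w le iw@(pw , nw , _) with G₁.factorize w pw nw
    ... | a , x , f₁@(pa , px , nx , e₁ , _) with G₂.factorize x px nx
    ... | b , c , f₂@(pb , pc , nc , e₂ , _) =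
      let a< = subst (length a <_) (cong length (sym e₁)) (G₁.length-<-◁ pa px nx)
          b< = <-≤-trans (subst (length b <_) (cong length (sym e₂)) (G₂.length-<-◁ pb pc nc))
                 (subst (length x ≤_) (sym (trans (cong length e₁) (G₁.length-◁ pa px nx))) (m≤n+m _ _))
          fa , Fa = F-total-≤ n a (s≤s⁻¹ (≤-trans a< le)) pa
          fb , Fb = F-total-≤ n b (s≤s⁻¹ (≤-trans b< le)) pb
      in Node c fa fb , T⁺ iw f₁ f₂ Fa Fb

    Ts-total-≤ : ∀ n ws → sum (map length ws) ≤ n → All Irreducible ws → ∃ λ f → Pointwise T ws f
    Ts-total-≤ n [] _ _ = [] , []
    Ts-total-≤ n (w ∷ ws) le (i ∷ is) =
      let t , Tw = T-total-≤ n w (≤-trans (m≤m+n _ _) le) i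
          f , Tws = Ts-total-≤ n ws (≤-trans (m≤n+m _ (length w)) le) is
      in t ∷ f , Tw ∷ Tws

    F-total-≤ : ∀ n w → length w ≤ n → Packed w → ∃ λ f → F w f
    F-total-≤ n w le pw with decompose w pw
    ... | ws , iws , refl =
      let f , Tws = Ts-total-≤ n (ord ws) (subst (_≤ n) (length-⊙-all-ord ws) le) (ord-All iws)
      in f , F⁺ ws iws Tws

  F-bijection : ∀ n → IsBijection (PW n) (BPF n) F
  F-bijection n = record
    { total = λ w (pw , _) → F-total-≤ (length w) w ≤-refl pw
    ; functional = λ _ f f' _ → F-functional f f'
    ; into = λ { _ f (_ , refl) Fw → F-bicolored f Fw , F-weight f Fw }
    ; injective = λ _ _ f _ _ Fw Fw' → trans (sym (F*-inverseˡ f Fw)) (F*-inverseˡ f Fw')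
    ; surjective = λ { f (bf , refl) → let Fw = F*-inverseʳ f bf in
                       F* f , (F-Packed Fw , sym (F-weight f Fw)) , Fw }
    }

  F-inverse : ∀ n → IsInverse (PW n) (BPF n) F F*
  F-inverse n = (λ _ f _ → F*-inverseˡ f) , λ { f (bf , refl) → let Fw = F*-inverseʳ f bf in
    (F-Packed Fw , sym (F-weight f Fw)) , Fw }

  T-bijection : ∀ n → IsBijection (IrrPW n) (BPT n) T
  T-bijection n = record
    { total = λ w (iw , _) → T-total-≤ (length w) w ≤-refl iw
    ; functional = λ _ t t' _ → T-functional t t'
    ; into = λ { _ t (_ , refl) Tw → T-bicolored t Tw , T-weight t Tw }
    ; injective = λ _ _ t _ _ Tw Tw' → trans (sym (T*-inverseˡ t Tw)) (T*-inverseˡ t Tw')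
    ; surjective = λ { t (bt , refl) → let iw , Tw = T*-inverseʳ t bt in
                       T* t , (iw , sym (T-weight t Tw)) , Tw }
    }

  T-inverse : ∀ n → IsInverse (IrrPW n) (BPT n) T T*
  T-inverse n = (λ _ t _ → T*-inverseˡ t) , λ { t (bt , refl) → let iw , Tw = T*-inverseʳ t bt in
    (iw , sym (T-weight t Tw)) , Tw }

-- Normal forms of the graftings

-- The local functions of positions and φ cannot be named from outside; they are the
-- solutions of the metavariables below, which unification reads off the two equations.
mutual
  positionsFrom : ℕ → Word → ℕ → Word → List ℕ
  positionsFrom m W j v = _

  positions-∷ : ∀ m x w → (x ≡ᵇ m) ≡ false → positions m (x ∷ w) ≡ positionsFrom m (x ∷ w) 2 w
  positions-∷ m x w e rewrite e with x ∷ w | 2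
  ... | W | j = refl

mutual
  fill : List ℕ → Word → ℕ → ℕ → Word → Word
  fill I W f j v = _

  φ-∷ : ∀ I x w → memb 1 I ≡ false → φ I (x ∷ w) ≡ x ∷ fill I (x ∷ w) (length w + length I) 2 w
  φ-∷ I x w e rewrite e with x ∷ w | 2 | length w + length I
  ... | W | j | f = refl

≡ᵇ-refl : ∀ m → (m ≡ᵇ m) ≡ true
≡ᵇ-refl m = dec-true (m ≟ m) refl

≢⇒≡ᵇ-false : ∀ {m n} → m ≢ n → (m ≡ᵇ n) ≡ false
≢⇒≡ᵇ-false {m} {n} = dec-false (m ≟ n)

-- Positions count from 0 here; `memb-positionsFrom-+` matches `k` with the number `j + k` in a list
-- of positions counted from `j`.
occursAt : ℕ → Word → ℕ → Bool
occursAt m [] k = false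
occursAt m (x ∷ v) zero = x ≡ᵇ m
occursAt m (x ∷ v) (suc k) = occursAt m v k

map-+-positionsFrom : ∀ m W l j v → map (l +_) (positionsFrom m W j v) ≡ positionsFrom m W (l + j) v
map-+-positionsFrom m W l j [] = refl
map-+-positionsFrom m W l j (x ∷ v) with x ≡ᵇ m
... | true = cong (l + j ∷_) (trans (map-+-positionsFrom m W l (suc j) v)
               (cong (λ i → positionsFrom m W i v) (+-suc l j)))
... | false = trans (map-+-positionsFrom m W l (suc j) v) (cong (λ i → positionsFrom m W i v) (+-suc l j))

memb-positionsFrom-< : ∀ m W i j v → i < j → memb i (positionsFrom m W j v) ≡ false
memb-positionsFrom-< m W i j [] l = refl
memb-positionsFrom-< m W i j (x ∷ v) l with x ≡ᵇ m
... | true = cong₂ _∨_ (≢⇒≡ᵇ-false (>⇒≢ l)) (memb-positionsFrom-< m W i (suc j) v (m<n⇒m<1+n l))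
... | false = memb-positionsFrom-< m W i (suc j) v (m<n⇒m<1+n l)

memb-positionsFrom-+ : ∀ m W j k v → memb (j + k) (positionsFrom m W j v) ≡ occursAt m v k
memb-positionsFrom-+ m W j k [] = refl
memb-positionsFrom-+ m W j zero (x ∷ v) with x ≡ᵇ m
... | true = cong (_∨ memb (j + 0) (positionsFrom m W (suc j) v))
               (trans (cong (j ≡ᵇ_) (+-identityʳ j)) (≡ᵇ-refl j))
... | false = memb-positionsFrom-< m W (j + 0) (suc j) v (s≤s (≤-reflexive (+-identityʳ j)))
memb-positionsFrom-+ m W j (suc k) (x ∷ v) with x ≡ᵇ m
... | true = cong₂ _∨_ (≢⇒≡ᵇ-false (m≢1+m+n j ∘ λ e → trans e (+-suc j k)))
    (trans (cong (λ i → memb i (positionsFrom m W (suc j) v)) (+-suc j k)) (memb-positionsFrom-+ m W (suc j) k v))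
... | false = trans (cong (λ i → memb i (positionsFrom m W (suc j) v)) (+-suc j k)) (memb-positionsFrom-+ m W (suc j) k v)

erase : ℕ → Word → Word
erase m = filter (λ x → ¬? (x ≟ m))

length-erase-positions : ∀ m W j v → length (erase m v) + length (positionsFrom m W j v) ≡ length v
length-erase-positions m W j [] = refl
length-erase-positions m W j (x ∷ v) with x ≡ᵇ m
... | true = trans (+-suc _ _) (cong suc (length-erase-positions m W (suc j) v))
... | false = cong suc (length-erase-positions m W (suc j) v)

replace : ℕ → ℕ → ℕ → ℕ
replace m n x = if x ≡ᵇ m then n else x

-- When `I` marks exactly the occurrences of `m`, refilling the holes left by `erase` puts the new
-- maximum where `m` was. The fuel counts output letters, hence `length v`.
fill-erase : ∀ I W m j v → (∀ k → memb (j + k) I ≡ occursAt m v k) →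
  fill I W (length v) j (erase m v) ≡ map (replace m (suc (maxW W))) v
fill-erase I W m j [] h = refl
fill-erase I W m j (x ∷ v) h rewrite trans (cong (λ i → memb i I) (sym (+-identityʳ j))) (h 0) with x ≡ᵇ m
... | true = cong (suc (maxW W) ∷_) (fill-erase I W m (suc j) v λ k →
               trans (cong (λ i → memb i I) (sym (+-suc j k))) (h (suc k)))
... | false = cong (x ∷_) (fill-erase I W m (suc j) v λ k →
               trans (cong (λ i → memb i I) (sym (+-suc j k))) (h (suc k)))

fill-++ : ∀ I W f j u v → (∀ i → i < length u + j → memb i I ≡ false) →
  fill I W (length u + f) j (u ++ v) ≡ u ++ fill I W f (length u + j) v
fill-++ I W f j [] v h = refl
fill-++ I W f j (x ∷ u) v h rewrite h j (s≤s (m≤n+m j (length u))) =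
  cong (x ∷_) (trans (fill-++ I W f (suc j) u v λ i l → h i (≤-trans l (≤-reflexive (+-suc (length u) j))))
    (cong (λ i → u ++ fill I W f i v) (+-suc (length u) j)))

-- All positions in `I` lie behind the copy of `u`, so `fill` first copies that unchanged and then
-- deals with `v` alone.
◁R-replace : ∀ u v →
  u ◁R v ≡ shift (maxW (red' v)) u ++ map (replace (maxW v) (suc (maxW (u ⊙ red' v)))) v
◁R-replace u v = begin
  fill (map (l +_) (positionsFrom m v 1 v)) W (length W + length (map (l +_) (positionsFrom m v 1 v))) 1 W
    ≡⟨ cong (λ I → fill I W (length W + length I) 1 W) (map-+-positionsFrom m v l 1 v) ⟩
  fill I W (length W + length I) 1 W
    ≡⟨ cong (λ f → fill I W f 1 W) fuel ⟩
  fill I W (length s + length v) 1 (s ++ erase m v)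
    ≡⟨ fill-++ I W (length v) 1 s (erase m v)
         (λ i lt → memb-positionsFrom-< m v i (l + 1) v (subst (λ n → i < n + 1) ls lt)) ⟩
  s ++ fill I W (length v) (length s + 1) (erase m v)
    ≡⟨ cong (λ n → s ++ fill I W (length v) (n + 1) (erase m v)) ls ⟩
  s ++ fill I W (length v) (l + 1) (erase m v)
    ≡⟨ cong (s ++_) (fill-erase I W m (l + 1) v (λ k → memb-positionsFrom-+ m v (l + 1) k v)) ⟩
  s ++ map (replace m (suc (maxW W))) v ∎
  where
  open ≡-Reasoning
  l = length u
  m = maxW v
  W = u ⊙ red' v
  s = shift (maxW (red' v)) u
  I = positionsFrom m v (l + 1) v
  ls : length s ≡ l
  ls = length-map _ u
  fuel : length W + length I ≡ length s + length v
  fuel = trans (cong (_+ length I) (length-++ s))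
    (trans (+-assoc (length s) _ _) (cong (length s +_) (length-erase-positions m v (l + 1) v)))

erase-Range : ∀ {k v} → Range (suc k) v → Range k (erase (suc k) v)
erase-Range {k} {v} (b , o) = b' , λ l u → ∈-filter⁺ _ (o l (m≤n⇒m≤1+n u)) (<⇒≢ (s≤s u))
  where
  b' : ∀ {i} → i ∈ erase (suc k) v → 1 ≤ i × i ≤ k
  b' p with ∈-filter⁻ (λ x → ¬? (x ≟ suc k)) {xs = v} p
  ... | q , n = proj₁ (b q) , s≤s⁻¹ (≤∧≢⇒< (proj₂ (b q)) n)

raise : ℕ → ℕ → ℕ → ℕ
raise m a = replace m (a + m)

red : ℕ → Word → Word → Word
red k u v = shift k u ++ map (raise (suc k) (maxW u)) v

-- Erasing `suc k` leaves the maximum `k`, so `φ` inserts the letter `suc (k + maxW u)`, which is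
-- `suc k` raised by `maxW u`.
◁R-red : ∀ {k u v} → Packed u → Range (suc k) v → u ◁R v ≡ red k u v
-- `maxW v` is replaced by a variable so that its equation with `suc k` can be matched.
◁R-red {k} {u} {v} pu rv = trans (◁R-replace u v) (lemma (maxW v) (Range⇒maxW rv))
  where
  lemma : ∀ m → m ≡ suc k → shift (maxW (erase m v)) u ++ map (replace m (suc (maxW (u ⊙ erase m v)))) v ≡ red k u v
  lemma m refl = cong₂ (λ i j → shift i u ++ map (replace m j) v) (Range⇒maxW re)
    (trans (cong suc (trans (maxW-⊙ {u} {erase m v} pu (Range⇒Packed re))
      (trans (cong (_+ maxW u) (Range⇒maxW re)) (+-comm k (maxW u))))) (sym (+-suc (maxW u) k)))
    where
    re = erase-Range {k} {v} rv

splitLast-∷ʳ : ∀ p i → splitLast (p ++ [ i ]) ≡ just (p , i)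
splitLast-∷ʳ [] i = refl
splitLast-∷ʳ (x ∷ p) i rewrite splitLast-∷ʳ p i = refl

memb-false⇒∉ : ∀ i p → memb i p ≡ false → i ∉ p
memb-false⇒∉ i (x ∷ p) e (here refl) with trans (sym (cong (_∨ memb i p) (≡ᵇ-refl i))) e
... | ()
memb-false⇒∉ i (x ∷ p) e (there q) with x ≡ᵇ i
memb-false⇒∉ i (x ∷ p) () (there q) | true
memb-false⇒∉ i (x ∷ p) e (there q) | false = memb-false⇒∉ i p e q

-- If `i` occurs in `p`, both sides are the same concatenation. Otherwise `ψ∘` undoes the lowering
-- of `p`, as no letter of `p` equals `i`, and it fixes `u`, whose letters lie below the threshold
-- `i + maxW u` because `i` is positive.
◁B-blue : ∀ {u p i} → 1 ≤ i → u ◁B (p ++ [ i ]) ≡ shift (maxW u) p ++ u ++ [ maxW u + i ]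
◁B-blue {u} {p} {i} 1≤i rewrite splitLast-∷ʳ p i with memb i p in eq
... | true = trans (++-assoc (shift (maxW u) p) u _) (cong (λ j → shift (maxW u) p ++ u ++ [ j ]) (+-comm i (maxW u)))
... | false = begin
  map inc (shift m (map dec p) ++ u) ++ [ i + m ]
    ≡⟨ cong (_++ [ i + m ]) (map-++ inc (shift m (map dec p)) u) ⟩
  (map inc (shift m (map dec p)) ++ map inc u) ++ [ i + m ]
    ≡⟨ cong₂ (λ a b → (a ++ b) ++ [ i + m ]) ep (map-id-on u eu) ⟩
  (shift m p ++ u) ++ [ i + m ]
    ≡⟨ trans (++-assoc (shift m p) u _) (cong (λ j → shift m p ++ u ++ [ j ]) (+-comm i m)) ⟩
  shift m p ++ u ++ [ m + i ] ∎
  where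
  open ≡-Reasoning
  m = maxW u
  inc dec : ℕ → ℕ
  inc x = if (i + m) ≤ᵇ x then suc x else x
  dec x = if i <ᵇ x then x ∸ 1 else x
  inc-≤ : ∀ {x} → i + m ≤ x → inc x ≡ suc x
  inc-≤ {x} h rewrite dec-true (i + m ≤? x) h = refl
  inc-> : ∀ {x} → x < i + m → inc x ≡ x
  inc-> {x} h rewrite dec-false (i + m ≤? x) (<⇒≱ h) = refl
  eu : ∀ {x} → x ∈ u → inc x ≡ x
  eu q = inc-> (≤-<-trans (∈⇒≤maxW q) (m<n+m m 1≤i))
  inc-dec : ∀ x → x ≢ i → inc (m + dec x) ≡ m + x
  inc-dec x x≢i with <-cmp i x
  inc-dec (suc x) x≢i | tri< i<x _ _ rewrite dec-true (i <? suc x) i<x =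
    trans (inc-≤ (≤-trans (≤-reflexive (+-comm i m)) (+-monoʳ-≤ m (s≤s⁻¹ i<x)))) (sym (+-suc m x))
  ... | tri≈ _ refl _ = ⊥-elim (x≢i refl)
  ... | tri> i≮x _ x<i rewrite dec-false (i <? x) i≮x =
    inc-> (<-≤-trans (+-monoʳ-< m x<i) (≤-reflexive (+-comm m i)))
  ep : map inc (shift m (map dec p)) ≡ shift m p
  ep = trans (cong (map inc) (sym (map-∘ p))) (trans (sym (map-∘ p))
    (map-cong-local (All.tabulate λ {x} q → inc-dec x λ { refl → memb-false⇒∉ i p eq q })))

-- The red grafting

Packed⇒Range-suc : ∀ {v} → Packed v → v ≢ [] → ∃ λ k → Range (suc k) v
Packed⇒Range-suc {v} pv nv with maxW v | Packed⇒Range pv | Packed⇒1≤maxW pv nv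
... | suc k | rv | _ = k , rv

Range-suc⇒≢[] : ∀ {k v} → Range (suc k) v → v ≢ []
Range-suc⇒≢[] (_ , o) refl with o (s≤s z≤n) ≤-refl
... | ()

raise-≡ : ∀ m a → raise m a m ≡ a + m
raise-≡ m a rewrite ≡ᵇ-refl m = refl

raise-≢ : ∀ {m x} a → x ≢ m → raise m a x ≡ x
raise-≢ a n rewrite ≢⇒≡ᵇ-false n = refl

raise-< : ∀ {m x} a → x < m → raise m a x ≡ x
raise-< a l = raise-≢ a (<⇒≢ l)

raise-0 : ∀ m x → raise m 0 x ≡ x
raise-0 m x with x ≟ m
... | yes refl = raise-≡ m 0
... | no n = raise-≢ 0 n

raise-increasing : ∀ m a x → x ≤ raise m a x
raise-increasing m a x with x ≟ m
... | yes refl = ≤-trans (m≤n+m m a) (≤-reflexive (sym (raise-≡ m a)))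
... | no n = ≤-reflexive (sym (raise-≢ a n))

raise-≤ : ∀ m a {x} → x ≤ m → raise m a x ≤ a + m
raise-≤ m a {x} l with x ≟ m
... | yes refl = ≤-reflexive (raise-≡ m a)
... | no n = ≤-trans (≤-reflexive (raise-≢ a n)) (≤-trans l (m≤n+m m a))

raise-<⇒< : ∀ m a {x} → x ≤ m → raise m a x < a + m → x < m
raise-<⇒< m a {x} l h = ≤∧≢⇒< l λ { refl → <-irrefl (raise-≡ m a) h }

raise-<⇒≡ : ∀ m a {x} → x ≤ m → raise m a x < a + m → raise m a x ≡ x
raise-<⇒≡ m a l h = raise-< a (raise-<⇒< m a l h)

-- A letter above `m` could coincide with the raised letter `a + m`, hence the restriction to
-- letters up to `m`.
raise-injective : ∀ m a {x y} → x ≤ m → y ≤ m → raise m a x ≡ raise m a y → x ≡ y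
raise-injective m a {x} {y} lx ly e with x ≟ m | y ≟ m
... | yes refl | yes refl = refl
... | no nx | no ny = trans (sym (raise-≢ a nx)) (trans e (raise-≢ a ny))
... | yes refl | no ny = ⊥-elim (<⇒≱ (≤∧≢⇒< ly ny)
        (≤-trans (m≤n+m m a) (≤-reflexive (trans (sym (raise-≡ m a)) (trans e (raise-≢ a ny))))))
... | no nx | yes refl = ⊥-elim (<⇒≱ (≤∧≢⇒< lx nx)
        (≤-trans (m≤n+m m a) (≤-reflexive (trans (sym (raise-≡ m a)) (trans (sym e) (raise-≢ a nx))))))

raise-raise : ∀ m a b {x} → x ≤ m → raise (b + m) a (raise m b x) ≡ raise m (a + b) x
raise-raise m a b {x} l with x ≟ m
... | yes refl = trans (cong (raise (b + m) a) (raise-≡ m b))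
    (trans (raise-≡ (b + m) a) (trans (sym (+-assoc a b m)) (sym (raise-≡ m (a + b)))))
... | no n = trans (cong (raise (b + m) a) (raise-≢ b n))
    (trans (raise-< a (<-≤-trans (≤∧≢⇒< l n) (m≤n+m m b))) (sym (raise-≢ (a + b) n)))

raise-shift : ∀ m k a x → raise (m + k) a (m + x) ≡ m + raise k a x
raise-shift m k a x with x ≟ k
... | yes refl = trans (raise-≡ (m + k) a) (trans (sym (+-assoc a m k))
    (trans (cong (_+ k) (+-comm a m)) (trans (+-assoc m a k) (cong (m +_) (sym (raise-≡ k a))))))
... | no n = trans (raise-≢ a (n ∘ +-cancelˡ-≡ m _ _)) (cong (m +_) (sym (raise-≢ a n)))

∈-shift-≤ : ∀ {k i} u → i ∈ shift k u → i ≤ k + maxW u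
∈-shift-≤ u p with ∈-shift⁻ u p
... | j , q , refl = +-monoʳ-≤ _ (∈⇒≤maxW q)

∈-shift-< : ∀ {k i u} → Packed u → i ∈ shift k u → k < i
∈-shift-< {k} {u = u} pu p with ∈-shift⁻ u p
... | j , q , refl = m<m+n k (Packed⇒1≤ pu q)

∈-shift-<max : ∀ {k i} u → i ∈ shift k u → i < maxW u + suc k
∈-shift-<max {k} u p = ≤-trans (s≤s (∈-shift-≤ u p))
  (≤-reflexive (trans (cong suc (+-comm k (maxW u))) (sym (+-suc (maxW u) k))))

module _ {k v} (rv : Range (suc k) v) where

  red-Range : ∀ {u} → Packed u → Range (maxW u + suc k) (red k u v)
  red-Range {u} pu = b , o
    where
    a = maxW u
    b : ∀ {i} → i ∈ red k u v → 1 ≤ i × i ≤ a + suc k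
    b p with ∈-++⁻ (shift k u) p
    ... | inj₁ q = ≤-<-trans z≤n (∈-shift-< pu q) , <⇒≤ (∈-shift-<max u q)
    ... | inj₂ q with ∈-map⁻ (raise (suc k) a) q
    ... | x , r , refl = ≤-trans (proj₁ (proj₁ rv r)) (raise-increasing (suc k) a x) ,
                         raise-≤ (suc k) a (proj₂ (proj₁ rv r))
    o : ∀ {i} → 1 ≤ i → i ≤ a + suc k → i ∈ red k u v
    -- Values up to `k` come from the letters of `v` left in place, the top value from the raised
    -- ones, and those in between from `u`.
    o {i} l h with i ≤? k
    ... | yes i≤k = ∈-++⁺ʳ (shift k u) (subst (_∈ map (raise (suc k) a) v) (raise-< a (s≤s i≤k))
                      (∈-map⁺ _ (proj₂ rv l (m≤n⇒m≤1+n i≤k))))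
    ... | no i≰k with i ≟ a + suc k
    ... | yes refl = ∈-++⁺ʳ (shift k u) (subst (_∈ map (raise (suc k) a) v) (raise-≡ (suc k) a)
                       (∈-map⁺ _ (proj₂ rv (s≤s z≤n) ≤-refl)))
    ... | no n with m≤n⇒∃[o]m+o≡n (≰⇒> i≰k)
    ... | j , refl = ∈-++⁺ˡ (subst (_∈ shift k u) (+-suc k j) (∈-map⁺ (k +_)
          (proj₂ (Packed⇒Range pu) (s≤s z≤n) (+-cancelˡ-≤ k _ _
            (≤-trans (≤-reflexive (+-suc k j)) (≤-trans (s≤s⁻¹ (≤-trans (≤∧≢⇒< h n) (≤-reflexive (+-suc a k))))
              (≤-reflexive (+-comm a k))))))))

  ∈-raise-max : ∀ a → a + suc k ∈ map (raise (suc k) a) v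
  ∈-raise-max a = subst (_∈ map (raise (suc k) a) v) (raise-≡ (suc k) a) (∈-map⁺ _ (proj₂ rv (s≤s z≤n) ≤-refl))

  -- The overall maximum cannot stand behind a descent. So the descent lies behind all raised
  -- letters, hence inside the copy of `v`, and `v` itself would have it.
  red-irreducible : ∀ {u} → Packed u → Irreducible v → Irreducible (red k u v)
  red-irreducible {u} pu iv = ¬Above⇒irreducible (Range⇒Packed (red-Range pu))
      (++-≢[]ʳ (shift k u) (map-≢[] (Range-suc⇒≢[] rv))) no-descent
    where
    a = maxW u
    r = raise (suc k) a
    no-descent : ∀ s t → red k u v ≡ s ++ t → s ≢ [] → t ≢ [] → ¬ Above s t
    no-descent s t e ns nt ab with ≤-total (length s) (length (shift k u))
    ... | inj₁ le with cut s t (shift k u) (map r v) (sym e) le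
    ... | q , _ , refl = max∉t (∈-++⁺ʳ q (∈-raise-max a))
      where
      max∉t : a + suc k ∉ q ++ map r v
      max∉t p = <⇒≱ (ab (maxW∈ ns) p)
        (proj₂ (proj₁ (red-Range pu) (subst (maxW s ∈_) (sym e) (∈-++⁺ˡ (maxW∈ ns)))))
    no-descent s t e ns nt ab | inj₂ le with cut (shift k u) (map r v) s t e le
    ... | q , es , et with map-split r v q et
    ... | v₁ , v₂ , ev , refl , refl = irreducible⇒¬Above iv v₁ v₂ ev n₁ (λ { refl → nt refl }) ab'
      where
      max∉t : a + suc k ∉ map r v₂
      max∉t p = <⇒≱ (ab (maxW∈ ns) p)
        (proj₂ (proj₁ (red-Range pu) (subst (maxW s ∈_) (sym e) (∈-++⁺ˡ (maxW∈ ns)))))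
      n₁ : v₁ ≢ []
      n₁ refl = max∉t (subst (λ z → a + suc k ∈ map r z) ev (∈-raise-max a))
      bound : ∀ {z} → z ∈ v₁ ++ v₂ → z ≤ suc k
      bound p = proj₂ (proj₁ rv (subst (_ ∈_) (sym ev) p))
      ab' : Above v₁ v₂
      ab' {x} {y} x∈ y∈ with x ≟ suc k
      ... | yes refl = ≤∧≢⇒< (bound (∈-++⁺ʳ v₁ y∈)) λ { refl →
              max∉t (subst (_∈ map r v₂) (raise-≡ (suc k) a) (∈-map⁺ r y∈)) }
      ... | no n = ≤-<-trans (raise-increasing (suc k) a y) (subst (r y <_) (raise-≢ a n)
              (ab (subst (r x ∈_) (sym es) (∈-++⁺ʳ (shift k u) (∈-map⁺ r x∈))) (∈-map⁺ r y∈)))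

  -- Behind a descent of `v` all letters are at most `k`, so raising fixes them, and they lie below
  -- the copy of `u`, whose letters exceed `k`.
  red-irreducible⁻ : ∀ {u} → Packed u → Irreducible (red k u v) → Irreducible v
  red-irreducible⁻ {u} pu iw = ¬Above⇒irreducible (Range⇒Packed rv) (Range-suc⇒≢[] rv) λ s t e ns nt ab →
    let open Descent s t e ns nt ab in
    irreducible⇒¬Above iw (shift k u ++ map r s) (map r t) split
      (++-≢[]ʳ (shift k u) (map-≢[] ns)) (map-≢[] nt) above
    where
    a = maxW u
    r = raise (suc k) a
    module Descent s t (e : v ≡ s ++ t) (ns : s ≢ []) (nt : t ≢ []) (ab : Above s t) where
      split : red k u v ≡ (shift k u ++ map r s) ++ map r t
      split = trans (cong (λ z → shift k u ++ map r z) e)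
        (trans (cong (shift k u ++_) (map-++ r s t)) (sym (++-assoc (shift k u) _ _)))
      t≤k : ∀ {y} → y ∈ t → y ≤ k
      t≤k y∈ = s≤s⁻¹ (≤-trans (ab (maxW∈ ns) y∈) (proj₂ (proj₁ rv (subst (_ ∈_) (sym e) (∈-++⁺ˡ (maxW∈ ns))))))
      above : Above (shift k u ++ map r s) (map r t)
      above x∈ y∈ with ∈-map⁻ r y∈
      ... | y , y∈t , refl rewrite raise-< a (s≤s (t≤k y∈t)) with ∈-++⁻ (shift k u) x∈
      ... | inj₁ q = ≤-<-trans (t≤k y∈t) (∈-shift-< pu q)
      ... | inj₂ q with ∈-map⁻ r q
      ... | x , x∈s , refl = <-≤-trans (ab x∈s y∈t) (raise-increasing (suc k) a x)

red-identityˡ : ∀ k v → red k [] v ≡ v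
red-identityˡ k v = trans (map-cong (raise-0 (suc k)) v) (map-id v)

length-red : ∀ k u v → length (red k u v) ≡ length u + length v
length-red k u v = trans (length-++ (shift k u)) (cong₂ _+_ (length-map _ u) (length-map _ v))

-- The inner word has maximum `maxW u' + suc k`, whence the index outside. The outer raising fixes
-- the copy of `u'` and composes with the inner one on `v`.
red-assoc : ∀ {k u u' v} → Packed u → Packed u' → Range (suc k) v →
  red (maxW u' + k) u (red k u' v) ≡ red k (u ⊙ u') v
red-assoc {k} {u} {u'} {v} pu pu' rv = begin
  shift (b + k) u ++ map r (shift k u' ++ map (raise (suc k) b) v)
    ≡⟨ cong (shift (b + k) u ++_) (map-++ r (shift k u') _) ⟩
  shift (b + k) u ++ map r (shift k u') ++ map r (map (raise (suc k) b) v)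
    ≡⟨ cong₂ (λ x y → shift (b + k) u ++ x ++ y) fixed raised ⟩
  shift (b + k) u ++ shift k u' ++ map r' v
    ≡⟨ cong (λ i → i ++ shift k u' ++ map r' v)
         (trans (cong (λ i → shift i u) (+-comm b k)) (sym (shift-shift k b u))) ⟩
  shift k (shift b u) ++ shift k u' ++ map r' v
    ≡⟨ ++-assoc (shift k (shift b u)) _ _ ⟨
  (shift k (shift b u) ++ shift k u') ++ map r' v
    ≡⟨ cong (_++ map r' v) (map-++ (k +_) (shift b u) u') ⟨
  shift k (u ⊙ u') ++ map r' v
    ≡⟨ cong (λ i → shift k (u ⊙ u') ++ map (raise (suc k) i) v)
         (trans (+-comm a b) (sym (maxW-⊙ {u} {u'} pu pu'))) ⟩
  red k (u ⊙ u') v ∎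
  where
  open ≡-Reasoning
  a = maxW u
  b = maxW u'
  r = raise (suc (b + k)) a
  r' = raise (suc k) (a + b)
  fixed : map r (shift k u') ≡ shift k u'
  fixed = map-id-on (shift k u') λ p → raise-< a (s≤s (≤-trans (∈-shift-≤ u' p) (≤-reflexive (+-comm k b))))
  raised : map r (map (raise (suc k) b) v) ≡ map r' v
  raised = trans (sym (map-∘ v)) (map-cong-local (All.tabulate λ {x} p →
    trans (cong (λ m → raise m a (raise (suc k) b x)) (sym (+-suc b k)))
      (raise-raise (suc k) a b (proj₂ (proj₁ rv p)))))

-- The copy of `u'` consists of the copy of `u` and a piece of the raised `v`. That piece lies below
-- the overall maximum, so raising did not change it, and lowering it by `k'` gives `q`. Comparing
-- heights shows that `q` has maximum `k ∸ k'`; injectivity of raising then identifies the rest of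
-- `v`.
red-cancel : ∀ {k u v k' u' v'} → Packed u → Range (suc k) v → Packed u' → Range (suc k') v' →
  length u ≤ length u' → red k u v ≡ red k' u' v' → ∃ λ q → Packed q × u' ≡ u ⊙ q × v ≡ red k' q v'
-- The general argument takes a letter of `u` to show `k' ≤ k`, so the empty word is treated apart.
red-cancel {k} {[]} {v} {k'} {u'} {v'} pu rv pu' rv' le e = u' , pu' , refl , trans (sym (red-identityˡ k v)) e
red-cancel {k} {u@(_ ∷ _)} {v} {k'} {u'} {v'} pu rv pu' rv' le e
  with cut (shift k u) (map (raise (suc k) (maxW u)) v) (shift k' u') _ e
         (subst₂ _≤_ (sym (length-map _ u)) (sym (length-map _ u')) le)
... | s , es , et with map-split _ v s et | map-split _ u' (shift k u) es
... | q₀ , t , refl , refl , er | u₁ , q , refl , eu , eq =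
  q , Range⇒Packed rq , eu'' , ev
  where
  a = maxW u
  a' = maxW (u₁ ++ q)
  r = raise (suc k) a
  max≡ : a + suc k ≡ a' + suc k'
  max≡ = trans (sym (Range⇒maxW (red-Range rv pu))) (trans (cong maxW e) (Range⇒maxW (red-Range rv' pu')))
  small : ∀ {x} → x ∈ q₀ → r x < a + suc k
  small {x} p = <-≤-trans (∈-shift-<max (u₁ ++ q) (subst (r x ∈_) (sym es) (∈-++⁺ʳ (shift k u) (∈-map⁺ r p))))
    (≤-reflexive (sym max≡))
  v≤ : ∀ {x} → x ∈ q₀ ++ t → x ≤ suc k
  v≤ p = proj₂ (proj₁ rv p)
  q₀≡ : shift k' q ≡ q₀
  q₀≡ = trans eq (map-id-on q₀ λ p → raise-<⇒≡ (suc k) a (v≤ (∈-++⁺ˡ p)) (small p))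
  q₀≤k : ∀ {x} → x ∈ q₀ → x ≤ k
  q₀≤k p = s≤s⁻¹ (raise-<⇒< (suc k) a (v≤ (∈-++⁺ˡ p)) (small p))
  k'≤k : k' ≤ k
  -- The letter 1 of `u` appears as `k + 1` in the copy of `u'`, where every letter exceeds `k'`.
  k'≤k with ∈-shift⁻ u₁ (subst (k + 1 ∈_) (sym eu) (∈-map⁺ (k +_) (Packed⇒1∈ pu λ ())))
  ... | y , y∈ , ey = s≤s⁻¹ (≤-trans (≤-trans (≤-reflexive (+-comm 1 k'))
      (+-monoʳ-≤ k' (Packed⇒1≤ pu' (∈-++⁺ˡ y∈)))) (≤-reflexive (trans (sym ey) (+-comm k 1))))
  d = k ∸ k'
  k≡ : k ≡ d + k'
  k≡ = sym (m∸n+n≡m k'≤k)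
  u₁≡ : u₁ ≡ shift d u
  u₁≡ = shift-injective k' (trans eu (trans (cong (λ i → shift i u) (trans k≡ (+-comm d k'))) (sym (shift-shift k' d u))))
  a'≡ : a' ≡ a + d
  a'≡ = +-cancelʳ-≡ (suc k') a' (a + d) (trans (sym max≡) (trans (cong (λ i → a + suc i) k≡)
    (trans (cong (a +_) (sym (+-suc d k'))) (sym (+-assoc a d (suc k'))))))
  rq : Range d q
  rq = (λ {x} p → Packed⇒1≤ pu' (∈-++⁺ʳ u₁ p) ,
         +-cancelˡ-≤ k' _ _ (≤-trans (q₀≤k (subst (k' + x ∈_) q₀≡ (∈-map⁺ (k' +_) p)))
           (≤-reflexive (trans k≡ (+-comm d k'))))) ,
       -- A letter of `u'` that is at most `d` cannot come from `u₁`, which is `u` shifted by `d`.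
       λ {i} l h → case ∈-++⁻ u₁ (proj₂ pu' i l (≤-trans h (≤-trans (m≤n+m d a) (≤-reflexive (sym a'≡))))) of λ where
         (inj₁ p) → ⊥-elim (<⇒≱ (∈-shift-< {u = u} pu (subst (i ∈_) u₁≡ p)) h)
         (inj₂ p) → p
  mq = Range⇒maxW rq
  eu'' : u₁ ++ q ≡ u ⊙ q
  eu'' = trans (cong (_++ q) u₁≡) (cong (λ i → shift i u ++ q) (sym mq))
  t≡ : t ≡ map (raise (suc k') d) v'
  t≡ = map-injective-on {f = r} {P = _≤ suc k} (raise-injective (suc k) a) t _ (v≤ ∘ ∈-++⁺ʳ q₀) bound
    (trans er (trans (map-cong-local (All.tabulate λ {x} p → sym (compose p))) (map-∘ v')))
    where
    sk≡ : suc k ≡ d + suc k'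
    sk≡ = trans (cong suc k≡) (sym (+-suc d k'))
    bound : ∀ {x} → x ∈ map (raise (suc k') d) v' → x ≤ suc k
    bound p with ∈-map⁻ (raise (suc k') d) p
    ... | y , y∈ , refl = ≤-trans (raise-≤ (suc k') d (proj₂ (proj₁ rv' y∈))) (≤-reflexive (sym sk≡))
    compose : ∀ {x} → x ∈ v' → r (raise (suc k') d x) ≡ raise (suc k') a' x
    compose {x} p = trans (cong (λ m → raise m a (raise (suc k') d x)) sk≡)
      (trans (raise-raise (suc k') a d (proj₂ (proj₁ rv' p))) (cong (λ i → raise (suc k') i x) (sym a'≡)))
  ev : q₀ ++ t ≡ red k' q v'
  ev = cong₂ _++_ (sym q₀≡) (trans t≡ (cong (λ i → map (raise (suc k') i) v') (sym mq)))

redGrafting : Grafting _◁R_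
redGrafting = record
  { _·_ = _⊙_
  ; ·-Packed = λ {u} {v} → ⊙-Packed {u} {v}
  ; length-· = length-⊙
  ; ·-identityʳ = ⊙-identityʳ
  ; ◁-identityˡ = λ {v} pv nv → let k , rv = Packed⇒Range-suc pv nv in
      trans (◁R-red {u = []} Packed-[] rv) (red-identityˡ k v)
  ; ◁-Range = λ {u} {v} pu pv nv → let k , rv = Packed⇒Range-suc pv nv in
      subst₂ (λ i w → Range (maxW u + i) w) (sym (Range⇒maxW rv)) (sym (◁R-red pu rv)) (red-Range rv pu)
  ; length-◁ = λ {u} {v} pu pv nv → let k , rv = Packed⇒Range-suc pv nv in
      trans (cong length (◁R-red pu rv)) (length-red k u v)
  ; ◁-assoc = assoc
  ; ◁-cancel = cancel
  ; ◁-irreducible = λ pu iv@(pv , nv , _) → let k , rv = Packed⇒Range-suc pv nv in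
      subst Irreducible (sym (◁R-red pu rv)) (red-irreducible rv pu iv)
  ; ◁-irreducible⁻ = λ pu pv nv iw → let k , rv = Packed⇒Range-suc pv nv in
      red-irreducible⁻ rv pu (subst Irreducible (◁R-red pu rv) iw)
  ; ◁-[1] = λ {u} pu → trans (◁R-red {0} {u} pu (Packed⇒Range Packed-[1]))
      (cong₂ (λ s i → s ++ [ i ]) (shift-0 u) (+-comm (maxW u) 1))
  }
  where
  assoc : ∀ {u v w} → Packed u → Packed v → Packed w → w ≢ [] → u ◁R (v ◁R w) ≡ (u ⊙ v) ◁R w
  assoc {u} {v} {w} pu pv pw nw with Packed⇒Range-suc pw nw
  ... | k , rw = trans (cong (u ◁R_) (◁R-red pv rw))
    (trans (◁R-red pu (subst (λ i → Range i (red k v w)) (+-suc (maxW v) k) (red-Range rw pv)))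
    (trans (red-assoc pu pv rw) (sym (◁R-red (⊙-Packed {u} {v} pu pv) rw))))
  cancel : ∀ {u v u' v'} → Packed u → Packed v → v ≢ [] → Packed u' → Packed v' → v' ≢ [] →
    length u ≤ length u' → u ◁R v ≡ u' ◁R v' → ∃ λ q → Packed q × u' ≡ u ⊙ q × v ≡ q ◁R v'
  cancel pu pv nv pu' pv' nv' le e with Packed⇒Range-suc pv nv | Packed⇒Range-suc pv' nv'
  ... | k , rv | k' , rv' with red-cancel pu rv pu' rv' le (trans (sym (◁R-red pu rv)) (trans e (◁R-red pu' rv')))
  ... | q , pq , e₁ , e₂ = q , pq , e₁ , trans e₂ (sym (◁R-red pq rv'))

-- The blue grafting

Range-resp-↭ : ∀ {m u v} → u ↭ v → Range m u → Range m v
Range-resp-↭ π (b , o) = (λ p → b (∈-resp-↭ (↭-sym π) p)) , λ l h → ∈-resp-↭ π (o l h)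

last-positive : ∀ {p i} → Packed (p ++ [ i ]) → 1 ≤ i
last-positive {p} pv = Packed⇒1≤ pv (∈-++⁺ʳ p (here refl))

-- The shift puts the positive letters of `q` above those of `u`, so `Above-split` applies; it asks
-- for a nonempty lower part, hence the separate case.
⊙-Packed⁻ˡ : ∀ {q u} → (∀ {x} → x ∈ q → 1 ≤ x) → Packed (q ⊙ u) → Packed q
⊙-Packed⁻ˡ {q} {[]} _ p = subst Packed (⊙-identityʳ q) p
⊙-Packed⁻ˡ {q} {u@(_ ∷ _)} h p with Above-split {shift (maxW u) q} {u} p (λ ()) above
  where
  above : Above (shift (maxW u) q) u
  above x∈ y∈ with ∈-shift⁻ q x∈
  ... | x , x∈q , refl = ≤-<-trans (∈⇒≤maxW y∈) (m<m+n (maxW u) (h x∈q))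
... | s , ps , _ , e = subst Packed (sym (shift-injective (maxW u) e)) ps

blue : Word → Word → ℕ → Word
blue u p i = shift (maxW u) p ++ u ++ [ maxW u + i ]

-- Up to order the letters are those of a `_⊙_`-product, so range and length are inherited from it.
blue-↭ : ∀ u p i → blue u p i ↭ (p ++ [ i ]) ⊙ u
blue-↭ u p i = ↭-trans (↭-++⁺ˡ (shift m p) (↭-++-comm u [ m + i ]))
  (↭-reflexive (trans (sym (++-assoc (shift m p) _ u)) (cong (_++ u) (sym (map-++ (m +_) p [ i ])))))
  where m = maxW u

blue-∷ʳ : ∀ u p i → blue u p i ≡ (shift (maxW u) p ++ u) ++ [ maxW u + i ]
blue-∷ʳ u p i = sym (++-assoc (shift (maxW u) p) u _)

blue-Range : ∀ {u p i n} → Packed u → Range n (p ++ [ i ]) → Range (maxW u + n) (blue u p i)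
blue-Range {u} {p} {i} pu rv = Range-resp-↭ (↭-sym (blue-↭ u p i)) (Range-⊙ rv (Packed⇒Range pu))

blue-assoc : ∀ {u v p i} → Packed u → Packed v → blue u (shift (maxW v) p ++ v) (maxW v + i) ≡ blue (v ⊙ u) p i
blue-assoc {u} {v} {p} {i} pu pv rewrite maxW-⊙ {v} {u} pv pu = begin
  shift a (shift b p ++ v) ++ u ++ [ a + (b + i) ]
    ≡⟨ cong₂ (λ x y → x ++ u ++ [ y ]) (trans (map-++ (a +_) (shift b p) v) (cong (_++ shift a v) (shift-shift a b p)))
         (sym (+-assoc a b i)) ⟩
  (shift (a + b) p ++ shift a v) ++ u ++ [ a + b + i ]
    ≡⟨ ++-assoc (shift (a + b) p) _ _ ⟩
  shift (a + b) p ++ shift a v ++ u ++ [ a + b + i ]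
    ≡⟨ cong (shift (a + b) p ++_) (++-assoc (shift a v) u _) ⟨
  shift (a + b) p ++ (v ⊙ u) ++ [ a + b + i ] ∎
  where
  open ≡-Reasoning
  a = maxW u
  b = maxW v

-- After the common last letter is removed, the longer `u'` begins within the copy of `p` or right
-- behind it. It is therefore a suffix `q` of `p`, shifted by `maxW u`, followed by `u`: literally
-- `q ⊙ u`.
blue-cancel : ∀ {u p i u' p' i'} → Packed u → Packed (p ++ [ i ]) → Packed u' →
  length u ≤ length u' → blue u p i ≡ blue u' p' i' →
  ∃ λ q → Packed q × u' ≡ q ⊙ u × p ++ [ i ] ≡ blue q p' i'
blue-cancel {u} {p} {i} {u'} {p'} {i'} pu pv pu' le e
  with ∷ʳ-injective _ _ (trans (sym (blue-∷ʳ u p i)) (trans e (blue-∷ʳ u' p' i')))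
... | e₁ , e₂ with cut (shift (maxW u') p') u' (shift (maxW u) p) u (sym e₁) p'≤p
  where
  lengths : length p + length u ≡ length p' + length u'
  lengths = trans (sym (trans (length-++ (shift (maxW u) p)) (cong (_+ length u) (length-map _ p))))
    (trans (cong length e₁) (trans (length-++ (shift (maxW u') p')) (cong (_+ length u') (length-map _ p'))))
  p'≤p : length (shift (maxW u') p') ≤ length (shift (maxW u) p)
  p'≤p = subst₂ _≤_ (sym (length-map _ p')) (sym (length-map _ p))
    (+-cancelʳ-≤ (length u) _ _ (≤-trans (+-monoʳ-≤ (length p') le) (≤-reflexive (sym lengths))))
... | _ , e₃ , refl with map-split _ p (shift (maxW u') p') e₃
... | p₁ , q , refl , e₄ , refl = q , pq , refl , trans (++-assoc p₁ q [ i ]) (cong₂ (λ x y → x ++ q ++ [ y ]) p₁≡ i≡)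
  where
  pq : Packed q
  pq = ⊙-Packed⁻ˡ {q} {u} (λ x∈ → Packed⇒1≤ pv (∈-++⁺ˡ (∈-++⁺ʳ p₁ x∈))) pu'
  max≡ : maxW (q ⊙ u) ≡ maxW u + maxW q
  max≡ = maxW-⊙ {q} {u} pq pu
  p₁≡ : p₁ ≡ shift (maxW q) p'
  p₁≡ = shift-injective (maxW u) (trans e₄ (trans (cong (λ k → shift k p') max≡) (sym (shift-shift (maxW u) (maxW q) p'))))
  i≡ : i ≡ maxW q + i'
  i≡ = +-cancelˡ-≡ (maxW u) _ _ (trans e₂ (trans (cong (_+ i') max≡) (+-assoc (maxW u) (maxW q) i')))

-- The last letter is at least `maxW u`, so no letter of `u` can stand in front of a descent. The
-- descent therefore lies within the copy of `p` or right behind it, and `p ++ [ i ]` has it too.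
blue-irreducible : ∀ {u p i} → Packed u → Irreducible (p ++ [ i ]) → Irreducible (blue u p i)
blue-irreducible {u} {p} {i} pu iv@(pv , _) =
  ¬Above⇒irreducible (Range⇒Packed (blue-Range {u} {p} pu (Packed⇒Range pv)))
    (++-≢[]ʳ (shift m p) (++-≢[]ʳ u λ ())) no-descent
  where
  m = maxW u
  no-descent : ∀ s t → blue u p i ≡ s ++ t → s ≢ [] → t ≢ [] → ¬ Above s t
  no-descent s t e ns nt ab with length s ≤? length (shift m p)
  ... | yes le with cut s t (shift m p) (u ++ [ m + i ]) (sym e) le
  ... | q , ep , refl with map-split (m +_) p s ep
  ... | p₁ , p₂ , refl , refl , refl =
    irreducible⇒¬Above iv p₁ (p₂ ++ [ i ]) (++-assoc p₁ p₂ [ i ]) (λ { refl → ns refl }) (++-≢[]ʳ p₂ λ ()) ab'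
    where
    ab' : Above p₁ (p₂ ++ [ i ])
    ab' x∈ y∈ with ∈-++⁻ p₂ y∈
    ... | inj₁ y∈p₂ = +-cancelˡ-< m _ _ (ab (∈-map⁺ (m +_) x∈) (∈-++⁺ˡ (∈-map⁺ (m +_) y∈p₂)))
    ... | inj₂ (here refl) = +-cancelˡ-< m _ _ (ab (∈-map⁺ (m +_) x∈) (∈-++⁺ʳ (shift m p₂) (∈-++⁺ʳ u (here refl))))
  no-descent s t e ns nt ab | no ≰ with cut (shift m p) (u ++ [ m + i ]) s t e (<⇒≤ (≰⇒> ≰))
  ... | [] , es , _ = ≰ (≤-reflexive (cong length (trans es (++-identityʳ _))))
  ... | q@(x ∷ _) , es , et with initLast t
  ... | [] = nt refl
  ... | t' ∷ʳ′ l with ∷ʳ-injective u (q ++ t') (trans et (sym (++-assoc q t' [ l ])))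
  ... | eu , el = <⇒≱ (ab (subst (x ∈_) (sym es) (∈-++⁺ʳ (shift m p) (here refl))) (∈-++⁺ʳ t' (here el)))
    (≤-trans (∈⇒≤maxW (subst (x ∈_) (sym eu) (here refl))) (m≤m+n m i))

-- The inserted `u` joins the lower part of a descent: every letter of the upper part has been
-- shifted beyond `maxW u`.
blue-irreducible⁻ : ∀ {u p i} → Packed (p ++ [ i ]) → Irreducible (blue u p i) → Irreducible (p ++ [ i ])
blue-irreducible⁻ {u} {p} {i} pv iw = ¬Above⇒irreducible pv (++-≢[]ʳ p λ ()) no-descent
  where
  m = maxW u
  no-descent : ∀ s t → p ++ [ i ] ≡ s ++ t → s ≢ [] → t ≢ [] → ¬ Above s t
  no-descent s t e ns nt ab with initLast t
  ... | [] = nt refl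
  ... | t' ∷ʳ′ l with ∷ʳ-injective p (s ++ t') (trans e (sym (++-assoc s t' [ l ])))
  ... | refl , refl = irreducible⇒¬Above iw (shift m s) (shift m t' ++ u ++ [ m + i ])
      (trans (cong (_++ u ++ [ m + i ]) (map-++ (m +_) s t')) (++-assoc (shift m s) _ _))
      (map-≢[] ns) (++-≢[]ʳ (shift m t') (++-≢[]ʳ u λ ())) ab'
    where
    ab' : Above (shift m s) (shift m t' ++ u ++ [ m + i ])
    ab' x∈ y∈ with ∈-shift⁻ s x∈ | ∈-++⁻ (shift m t') y∈
    ... | x , x∈s , refl | inj₁ q with ∈-shift⁻ t' q
    ... | y , y∈t' , refl = +-monoʳ-< m (ab x∈s (∈-++⁺ˡ y∈t'))
    ab' x∈ y∈ | x , x∈s , refl | inj₂ q with ∈-++⁻ u q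
    ... | inj₁ y∈u = ≤-<-trans (∈⇒≤maxW y∈u) (m<m+n m (Packed⇒1≤ pv (∈-++⁺ˡ (∈-++⁺ˡ x∈s))))
    ... | inj₂ (here refl) = +-monoʳ-< m (ab x∈s (∈-++⁺ʳ t' (here refl)))

data Snoc : Word → Set where
  snoc : ∀ p i → Snoc (p ++ [ i ])

≢[]⇒Snoc : ∀ {v} → v ≢ [] → Snoc v
≢[]⇒Snoc {v} nv with initLast v
... | [] = ⊥-elim (nv refl)
... | p ∷ʳ′ i = snoc p i

blueGrafting : Grafting _◁B_
blueGrafting = record
  { _·_ = λ u v → v ⊙ u
  ; ·-Packed = λ {u} {v} pu pv → ⊙-Packed {v} {u} pv pu
  ; length-· = λ u v → trans (length-⊙ v u) (+-comm (length v) (length u))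
  ; ·-identityʳ = λ _ → refl
  ; ◁-identityˡ = identityˡ
  ; ◁-Range = range
  ; length-◁ = len
  ; ◁-assoc = assoc
  ; ◁-cancel = cancel
  ; ◁-irreducible = irr
  ; ◁-irreducible⁻ = irr⁻
  ; ◁-[1] = λ {u} _ → trans (◁B-blue {u} {[]} ≤-refl) (cong (λ i → u ++ [ i ]) (+-comm (maxW u) 1))
  }
  where
  form : ∀ {p i} u → Packed (p ++ [ i ]) → u ◁B (p ++ [ i ]) ≡ blue u p i
  form {p} u pv = ◁B-blue {u} {p} (last-positive {p} pv)
  identityˡ : ∀ {v} → Packed v → v ≢ [] → [] ◁B v ≡ v
  identityˡ pv nv with ≢[]⇒Snoc nv
  ... | snoc p i = trans (form {p} [] pv) (cong (_++ [ i ]) (shift-0 p))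
  range : ∀ {u v} → Packed u → Packed v → v ≢ [] → Range (maxW u + maxW v) (u ◁B v)
  range {u} pu pv nv with ≢[]⇒Snoc nv
  ... | snoc p i = subst (Range _) (sym (form {p} u pv)) (blue-Range {u} {p} pu (Packed⇒Range pv))
  len : ∀ {u v} → Packed u → Packed v → v ≢ [] → length (u ◁B v) ≡ length u + length v
  len {u} pu pv nv with ≢[]⇒Snoc nv
  ... | snoc p i = trans (cong length (form {p} u pv)) (trans (↭-length (blue-↭ u p i))
          (trans (length-⊙ (p ++ [ i ]) u) (+-comm _ (length u))))
  assoc : ∀ {u v w} → Packed u → Packed v → Packed w → w ≢ [] → u ◁B (v ◁B w) ≡ (v ⊙ u) ◁B w
  assoc {u} {v} pu pv pw nw with ≢[]⇒Snoc nw
  ... | snoc p i = trans (cong (u ◁B_) (trans (form {p} v pw) (blue-∷ʳ v p i)))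
    (trans (◁B-blue {u} {shift (maxW v) p ++ v} (≤-trans (last-positive {p} pw) (m≤n+m i (maxW v))))
    (trans (blue-assoc {u} {v} {p} pu pv) (sym (form {p} (v ⊙ u) pw))))
  cancel : ∀ {u v u' v'} → Packed u → Packed v → v ≢ [] → Packed u' → Packed v' → v' ≢ [] →
    length u ≤ length u' → u ◁B v ≡ u' ◁B v' → ∃ λ q → Packed q × u' ≡ q ⊙ u × v ≡ q ◁B v'
  cancel {u} {u' = u'} pu pv nv pu' pv' nv' le e with ≢[]⇒Snoc nv | ≢[]⇒Snoc nv'
  ... | snoc p i | snoc p' i'
    with blue-cancel {u} {p} {i} {u'} {p'} {i'} pu pv pu' le (trans (sym (form {p} u pv)) (trans e (form {p'} u' pv')))
  ... | q , pq , e₁ , e₂ = q , pq , e₁ , trans e₂ (sym (form {p'} q pv'))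
  irr : ∀ {u v} → Packed u → Irreducible v → Irreducible (u ◁B v)
  irr {u} pu iv@(pv , nv , _) with ≢[]⇒Snoc nv
  ... | snoc p i = subst Irreducible (sym (form {p} u pv)) (blue-irreducible {u} {p} pu iv)
  irr⁻ : ∀ {u v} → Packed u → Packed v → v ≢ [] → Irreducible (u ◁B v) → Irreducible v
  irr⁻ {u} pu pv nv iw with ≢[]⇒Snoc nv
  ... | snoc p i = blue-irreducible⁻ {u} {p} pv (subst Irreducible (form {p} u pv) iw)

-- Interaction of the two graftings

module R = Grafting redGrafting
module B = Grafting blueGrafting

-- The letters of `b` lie below the maximum, so raising fixes them; on the letters shifted by
-- `maxW b`, raising commutes with the shift.
red-blue-commute : ∀ {k a b p i} → Range (suc k) (p ++ [ i ]) →
  red (maxW b + k) a (blue b p i) ≡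
  blue b (shift k a ++ map (raise (suc k) (maxW a)) p) (raise (suc k) (maxW a) i)
red-blue-commute {k} {a} {b} {p} {i} rv = begin
  shift (m + k) a ++ map r' (shift m p ++ b ++ [ m + i ])
    ≡⟨ cong₂ _++_ (sym (shift-shift m k a)) (trans (map-++ r' (shift m p) _)
         (cong (map r' (shift m p) ++_) (map-++ r' b _))) ⟩
  shift m (shift k a) ++ map r' (shift m p) ++ map r' b ++ [ r' (m + i) ]
    ≡⟨ cong₂ (λ x y → shift m (shift k a) ++ x ++ y) ep (cong₂ (λ x y → x ++ [ y ]) eb (r'-shift i)) ⟩
  shift m (shift k a) ++ shift m (map r p) ++ b ++ [ m + r i ]
    ≡⟨ ++-assoc (shift m (shift k a)) _ _ ⟨
  (shift m (shift k a) ++ shift m (map r p)) ++ b ++ [ m + r i ]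
    ≡⟨ cong (_++ b ++ [ m + r i ]) (map-++ (m +_) (shift k a) (map r p)) ⟨
  shift m (shift k a ++ map r p) ++ b ++ [ m + r i ] ∎
  where
  open ≡-Reasoning
  m = maxW b
  r = raise (suc k) (maxW a)
  r' = raise (suc (m + k)) (maxW a)
  r'-shift : ∀ x → r' (m + x) ≡ m + r x
  r'-shift x = trans (cong (λ j → raise j (maxW a) (m + x)) (sym (+-suc m k))) (raise-shift m (suc k) (maxW a) x)
  ep : map r' (shift m p) ≡ shift m (map r p)
  ep = trans (sym (map-∘ p)) (trans (map-cong r'-shift p) (map-∘ p))
  eb : map r' b ≡ b
  eb = map-id-on b λ x∈ → raise-< (maxW a) (s≤s (≤-trans (∈⇒≤maxW x∈) (m≤m+n m k)))

◁R-◁B-commute : ∀ {a b c} → Packed a → Packed b → Packed c → c ≢ [] → a ◁R (b ◁B c) ≡ b ◁B (a ◁R c)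
◁R-◁B-commute {a} {b} pa pb pc nc with Packed⇒Range-suc pc nc | ≢[]⇒Snoc nc
... | k , rc | snoc p i = begin
  a ◁R (b ◁B (p ++ [ i ]))
    ≡⟨ cong (a ◁R_) (◁B-blue {b} {p} 1≤i) ⟩
  a ◁R blue b p i
    ≡⟨ ◁R-red pa (subst (λ n → Range n (blue b p i)) (+-suc (maxW b) k) (blue-Range {b} {p} pb rc)) ⟩
  red (maxW b + k) a (blue b p i)
    ≡⟨ red-blue-commute {k} {a} {b} {p} rc ⟩
  blue b (shift k a ++ map r p) (r i)
    ≡⟨ ◁B-blue {b} {shift k a ++ map r p} (≤-trans 1≤i (raise-increasing (suc k) (maxW a) i)) ⟨
  b ◁B ((shift k a ++ map r p) ++ [ r i ])
    ≡⟨ cong (b ◁B_) (trans (++-assoc (shift k a) _ _) (cong (shift k a ++_) (sym (map-++ r p [ i ])))) ⟩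
  b ◁B red k a (p ++ [ i ])
    ≡⟨ cong (b ◁B_) (◁R-red pa rc) ⟨
  b ◁B (a ◁R (p ++ [ i ])) ∎
  where
  open ≡-Reasoning
  r = raise (suc k) (maxW a)
  1≤i = last-positive {p} pc

-- Such a word is both p ◁R 1 and p ◁B 1.
EndsInMax : Word → Set
EndsInMax w = ∃ λ p → Packed p × w ≡ p ++ [ suc (maxW p) ]

endsInMax : ∀ {k p i} → Range (suc k) (p ++ [ i ]) → (∀ {x} → x ∈ p → x < suc k) → EndsInMax (p ++ [ i ])
endsInMax {k} {p} {i} (b , o) h with ∈-++⁻ p (o (s≤s z≤n) ≤-refl)
... | inj₁ k∈p = ⊥-elim (n≮n _ (h k∈p))
... | inj₂ (here refl) = p , Range⇒Packed rp , cong (λ j → p ++ [ suc j ]) (sym (Range⇒maxW rp))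
  where
  rp : Range k p
  rp = (λ x∈ → proj₁ (b (∈-++⁺ˡ x∈)) , s≤s⁻¹ (h x∈)) , λ {j} l u →
    case ∈-++⁻ p (o l (m≤n⇒m≤1+n u)) of λ where
      (inj₁ q) → q
      (inj₂ (here refl)) → ⊥-elim (n≮n k u)

module Exchange {k l a b p i x} (pa : Packed a) (pb : Packed b)
  (rc : Range (suc l) (p ++ [ i ])) (rx : Range (suc k) x) (e : blue b p i ≡ red k a x) where

  private
    m = maxW b
    r = raise (suc k) (maxW a)

  max≡ : m + suc l ≡ maxW a + suc k
  max≡ = trans (sym (Range⇒maxW (blue-Range {b} {p} pb rc))) (trans (cong maxW e) (Range⇒maxW (red-Range rx pa)))

  m<max : m < maxW a + suc k
  m<max = <-≤-trans (m<m+n m z<s) (≤-reflexive max≡)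

  -- The copy of `p` lies inside that of `a`, hence below the overall maximum, and the raised `x`
  -- without its last letter lies inside `b`, also below it. So each maximum is attained only at the
  -- end.
  crossing : length p < length a → EndsInMax (p ++ [ i ]) × EndsInMax x
  crossing lt with cut (shift m p) (b ++ [ m + i ]) (shift k a) (map r x) e
                    (subst₂ _≤_ (sym (length-map _ p)) (sym (length-map _ a)) (<⇒≤ lt))
                | ≢[]⇒Snoc (Range-suc⇒≢[] rx)
  ... | s , ea , eb | snoc q j
    with ∷ʳ-injective b (s ++ map r q) (trans eb (trans (cong (s ++_) (map-++ r q [ j ])) (sym (++-assoc s _ _))))
  ... | eb' , _ =
    endsInMax {l} {p} rc (λ {y} y∈ → +-cancelˡ-< m _ _ (<-≤-trans
      (∈-shift-<max a (subst (m + y ∈_) (sym ea) (∈-++⁺ˡ (∈-map⁺ (m +_) y∈)))) (≤-reflexive (sym max≡)))) ,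
    endsInMax {k} {q} rx (λ {y} y∈ → raise-<⇒< (suc k) (maxW a) (proj₂ (proj₁ rx (∈-++⁺ˡ y∈)))
      (≤-<-trans (∈⇒≤maxW (subst (r y ∈_) (sym eb') (∈-++⁺ʳ s (∈-map⁺ r y∈)))) m<max))

  -- Here `x` is `P ++ B ++ [ j ]` with `B` at the place of `b`. Since `b` stays below the overall
  -- maximum, raising did not change `B`, so `B ≡ b`. All letters of `P ++ [ j ]` exceed `maxW b`,
  -- and lowering them by it gives `c'`.
  nested : a ≢ [] → length a ≤ length p → ∃ λ c' → Packed c' × c' ≢ [] × x ≡ b ◁B c'
  nested na le with cut (shift k a) (map r x) (shift m p) (b ++ [ m + i ]) (sym e)
                      (subst₂ _≤_ (sym (length-map _ a)) (sym (length-map _ p)) le)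
  ... | s , ep , ex with map-split (m +_) p (shift k a) ep
  ... | p₁ , p₂ , refl , ea , refl with map-split r x (shift m p₂) ex
  ... | P , BI , refl , eP , eBI with map-split r BI b eBI
  ... | B , j ∷ [] , refl , eB , ej =
    let w , ew = unshift m (P ++ [ j ]) (<⇒≤ ∘ above) in finish w ew
    where
    image : ∀ {y} → y ∈ P ++ [ j ] → m < r y
    image {y} y∈ with ∈-++⁻ P y∈
    ... | inj₁ q with ∈-shift⁻ p₂ (subst (r y ∈_) eP (∈-map⁺ r q))
    ... | z , z∈ , ez = subst (m <_) (sym ez) (m<m+n m (proj₁ (proj₁ rc (∈-++⁺ˡ (∈-++⁺ʳ p₁ z∈)))))
    image y∈ | inj₂ (here refl) = subst (m <_) (sym (∷-injectiveˡ ej))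
      (m<m+n m (proj₁ (proj₁ rc (∈-++⁺ʳ (p₁ ++ p₂) (here refl)))))
    m≤k : m ≤ k
    -- The letter 1 of `a` appears as `k + 1`, which is also a letter of `p` shifted by `m`.
    m≤k with ∈-shift⁻ p₁ (subst (k + 1 ∈_) (sym ea) (∈-map⁺ (k +_) (Packed⇒1∈ pa na)))
    ... | z , z∈ , ez = s≤s⁻¹ (≤-trans (m<m+n m (proj₁ (proj₁ rc (∈-++⁺ˡ (∈-++⁺ˡ z∈)))))
                          (≤-reflexive (trans (sym ez) (+-comm k 1))))
    above : ∀ {y} → y ∈ P ++ [ j ] → m < y
    above {y} y∈ with y ≟ suc k
    ... | yes refl = s≤s m≤k
    ... | no n = subst (m <_) (raise-≢ (maxW a) n) (image y∈)
    B≡b : B ≡ b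
    B≡b = trans (sym (map-id-on B λ {y} y∈ → raise-<⇒≡ (suc k) (maxW a)
      (proj₂ (proj₁ rx (∈-++⁺ʳ P (∈-++⁺ˡ y∈))))
      (≤-<-trans (∈⇒≤maxW (subst (r y ∈_) eB (∈-map⁺ r y∈))) m<max))) eB
    to-x : ∀ {y} → y ∈ P ++ [ j ] → y ∈ P ++ B ++ [ j ]
    to-x y∈ with ∈-++⁻ P y∈
    ... | inj₁ q = ∈-++⁺ˡ q
    ... | inj₂ q = ∈-++⁺ʳ P (∈-++⁺ʳ B q)
    from-x : ∀ {y} → m < y → y ∈ P ++ B ++ [ j ] → y ∈ P ++ [ j ]
    from-x m<y y∈ with ∈-++⁻ P y∈
    ... | inj₁ q = ∈-++⁺ˡ q
    ... | inj₂ q with ∈-++⁻ B q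
    ... | inj₁ q' = ⊥-elim (<⇒≱ m<y (∈⇒≤maxW (subst (_ ∈_) B≡b q')))
    ... | inj₂ q' = ∈-++⁺ʳ P q'
    finish : ∀ w → P ++ [ j ] ≡ shift m w → ∃ λ c' → Packed c' × c' ≢ [] × P ++ B ++ [ j ] ≡ b ◁B c'
    finish w ew with initLast w
    ... | [] = ⊥-elim (++-≢[]ʳ P (λ ()) ew)
    ... | P' ∷ʳ′ j' with ∷ʳ-injective P (shift m P') (trans ew (map-++ (m +_) P' [ j' ]))
    ... | refl , refl = P' ++ [ j' ] , Range⇒Packed rw , ++-≢[]ʳ P' (λ ()) ,
        trans (cong (λ z → shift m P' ++ z ++ [ m + j' ]) B≡b)
          (sym (◁B-blue {b} {P'} (last-positive {P'} (Range⇒Packed rw))))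
      where
      w' = P' ++ [ j' ]
      sk≡ : suc k ≡ m + suc (k ∸ m)
      sk≡ = trans (cong suc (sym (m+[n∸m]≡n m≤k))) (sym (+-suc m (k ∸ m)))
      shifted : ∀ {y} → y ∈ w' → m + y ∈ shift m P' ++ [ m + j' ]
      shifted {y} y∈ = subst (m + y ∈_) (sym ew) (∈-map⁺ (m +_) y∈)
      rw : Range (suc (k ∸ m)) w'
      rw = (λ {y} y∈ →
              +-cancelˡ-≤ m _ _ (≤-trans (≤-reflexive (+-comm m 1)) (above (shifted y∈))) ,
              +-cancelˡ-≤ m _ _ (≤-trans (proj₂ (proj₁ rx (to-x (shifted y∈)))) (≤-reflexive sk≡))) ,
           λ {y} l h → ∈-shift-cancel w' (subst (m + y ∈_) ew (from-x (m<m+n m l)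
              (proj₂ rx (≤-trans l (m≤n+m y m)) (≤-trans (+-monoʳ-≤ m h) (≤-reflexive (sym sk≡))))))

-- For nonempty `a`, only `x ≡ b ◁B c'` is read off from the words; `c ≡ a ◁R c'` follows by
-- commuting the graftings and cancelling `b`.
◁-exchange : ∀ {a b c x} → Packed a → Packed b → Packed c → c ≢ [] → Packed x → x ≢ [] → b ◁B c ≡ a ◁R x →
  (∃ λ c' → Packed c' × c' ≢ [] × x ≡ b ◁B c' × c ≡ a ◁R c') ⊎ (EndsInMax c × EndsInMax x)
◁-exchange {[]} {c = c} pa pb pc nc px nx e =
  inj₁ (c , pc , nc , sym (trans e (R.◁-identityˡ px nx)) , sym (R.◁-identityˡ pc nc))
◁-exchange {a@(_ ∷ _)} {b} pa pb pc nc px nx e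
  with Packed⇒Range-suc pc nc | ≢[]⇒Snoc nc | Packed⇒Range-suc px nx
... | l , rc | snoc p i | k , rx with length a ≤? length p
... | no ≰ = inj₂ (Exchange.crossing {p = p} pa pb rc rx
    (trans (sym (◁B-blue {b} {p} (last-positive {p} pc))) (trans e (◁R-red pa rx))) (≰⇒> ≰))
... | yes le with Exchange.nested {p = p} pa pb rc rx
    (trans (sym (◁B-blue {b} {p} (last-positive {p} pc))) (trans e (◁R-red pa rx))) (λ ()) le
... | c' , pc' , nc' , refl = inj₁ (c' , pc' , nc' , refl ,
    proj₂ (B.◁-injective pb pc nc pb (R.◁-Packed pa pc' nc') (R.◁-≢[] pa pc' nc') refl
      (trans e (◁R-◁B-commute pa pb pc' nc'))))

-- The red-blue and blue-red trees as instances

[1]-irreducible : Irreducible [ 1 ]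
[1]-irreducible = Packed-[1] , (λ ()) , λ { c (1≤c , s≤s c≤0 , _) → n≮n 0 (≤-trans 1≤c c≤0) }

-- Both constructors of `BPTree` are covered by one condition that treats the colours alike, so it
-- serves either order of factorization.
BPTree-node⁺ : ∀ {c fl fr} → Irreducible c → Prime _◁R_ c → Prime _◁B_ c → (c ≡ [ 1 ] → fr ≡ []) →
  BPForest fl → BPForest fr → BPTree (Node c fl fr)
BPTree-node⁺ {c} ic red-prime blue-prime one bl br with c ≟W [ 1 ]
... | no n = bp-irr n (ic , red-prime) (ic , blue-prime) bl br
... | yes refl with one refl
... | refl = bp-one bl

BPTree-node⁻ : ∀ {c fl fr} → BPTree (Node c fl fr) →
  Irreducible c × Prime _◁R_ c × Prime _◁B_ c × (c ≡ [ 1 ] → fr ≡ []) × BPForest fl × BPForest fr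
BPTree-node⁻ (bp-one bl) = [1]-irreducible , R.prime-[1] , B.prime-[1] , (λ _ → refl) , bl , []
BPTree-node⁻ (bp-irr n (ic , red-prime) (_ , blue-prime) bl br) =
  ic , red-prime , blue-prime , (λ e → ⊥-elim (n e)) , bl , br

T-RBs⁺ : ∀ {ws f} → Pointwise T-RB ws f → T-RBs ws f
T-RBs⁺ [] = []
T-RBs⁺ (t ∷ ts) = t ∷ T-RBs⁺ ts

T-RBs⁻ : ∀ {ws f} → T-RBs ws f → Pointwise T-RB ws f
T-RBs⁻ [] = []
T-RBs⁻ (t ∷ ts) = t ∷ T-RBs⁻ ts

T-BRs⁺ : ∀ {ws f} → Pointwise T-BR ws f → T-BRs ws f
T-BRs⁺ [] = []
T-BRs⁺ (t ∷ ts) = t ∷ T-BRs⁺ ts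

T-BRs⁻ : ∀ {ws f} → T-BRs ws f → Pointwise T-BR ws f
T-BRs⁻ [] = []
T-BRs⁻ (t ∷ ts) = t ∷ T-BRs⁻ ts

F-RB⁺ : ∀ ws {f} → All Irreducible ws → Pointwise T-RB ws f → F-RB (⊙-all ws) f
F-RB⁺ ws iws ts = f-rb ws iws refl (T-RBs⁺ ts)

F-RB⁻ : ∀ {w f} → F-RB w f → ∃ λ ws → All Irreducible ws × w ≡ ⊙-all ws × Pointwise T-RB ws f
F-RB⁻ (f-rb ws iws e ts) = ws , iws , e , T-RBs⁻ ts

T-RB⁻ : ∀ {w c fl fr} → T-RB w (Node c fl fr) → ∃ λ a → ∃ λ x → ∃ λ b →
  Irreducible w × RedFact w a x × BlueFact x b c × F-RB a fl × F-RB b fr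
T-RB⁻ (t-rb iw f₁ f₂ Fa Fb) = _ , _ , _ , iw , f₁ , f₂ , Fa , Fb

F-BR⁺ : ∀ ws {f} → All Irreducible ws → Pointwise T-BR (reverse ws) f → F-BR (⊙-all ws) f
F-BR⁺ ws iws ts = f-br ws iws refl (T-BRs⁺ ts)

F-BR⁻ : ∀ {w f} → F-BR w f → ∃ λ ws → All Irreducible ws × w ≡ ⊙-all ws × Pointwise T-BR (reverse ws) f
F-BR⁻ (f-br ws iws e ts) = ws , iws , e , T-BRs⁻ ts

T-BR⁻ : ∀ {w c fl fr} → T-BR w (Node c fl fr) → ∃ λ b → ∃ λ y → ∃ λ a →
  Irreducible w × BlueFact w b y × RedFact y a c × F-BR b fl × F-BR a fr
T-BR⁻ (t-br iw f₁ f₂ Fb Fa) = _ , _ , _ , iw , f₁ , f₂ , Fb , Fa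

-- Each order of the colours takes one half of the symmetric exchange, the half about the word on
-- which the second grafting acts.
red-exchange : ∀ {a b c x} → Packed a → Packed b → Packed c → c ≢ [] → Packed x → x ≢ [] → b ◁B c ≡ a ◁R x →
  (∃ λ c' → Packed c' × c' ≢ [] × c ≡ a ◁R c') ⊎ EndsInMax c
red-exchange pa pb pc nc px nx e with ◁-exchange pa pb pc nc px nx e
... | inj₁ (c' , pc' , nc' , _ , ec) = inj₁ (c' , pc' , nc' , ec)
... | inj₂ (end , _) = inj₂ end

blue-exchange : ∀ {b a x c} → Packed b → Packed a → Packed x → x ≢ [] → Packed c → c ≢ [] → a ◁R x ≡ b ◁B c →
  (∃ λ x' → Packed x' × x' ≢ [] × x ≡ b ◁B x') ⊎ EndsInMax x
blue-exchange pb pa px nx pc nc e with ◁-exchange pa pb pc nc px nx (sym e)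
... | inj₁ (x' , px' , nx' , ex , _) = inj₁ (x' , px' , nx' , ex)
... | inj₂ (_ , end) = inj₂ end

◁B-◁R-commute : ∀ {b a c} → Packed b → Packed a → Packed c → c ≢ [] → b ◁B (a ◁R c) ≡ a ◁R (b ◁B c)
◁B-◁R-commute pb pa pc nc = sym (◁R-◁B-commute pa pb pc nc)

BPTree-node-swap⁺ : ∀ {c fl fr} → Irreducible c → Prime _◁B_ c → Prime _◁R_ c → (c ≡ [ 1 ] → fr ≡ []) →
  BPForest fl → BPForest fr → BPTree (Node c fl fr)
BPTree-node-swap⁺ ic blue-prime red-prime = BPTree-node⁺ ic red-prime blue-prime

BPTree-node-swap⁻ : ∀ {c fl fr} → BPTree (Node c fl fr) →
  Irreducible c × Prime _◁B_ c × Prime _◁R_ c × (c ≡ [ 1 ] → fr ≡ []) × BPForest fl × BPForest fr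
BPTree-node-swap⁻ bt with BPTree-node⁻ bt
... | ic , red-prime , blue-prime , rest = ic , blue-prime , red-prime , rest

module RB = TreeBijection redGrafting blueGrafting ◁R-◁B-commute red-exchange
  id (λ _ → ↭-refl) (λ _ → refl) BPTree-node⁺ BPTree-node⁻ F-RB T-RB F-RB⁺ F-RB⁻ t-rb T-RB⁻

module BR = TreeBijection blueGrafting redGrafting ◁B-◁R-commute blue-exchange
  reverse ↭-reverse reverse-involutive BPTree-node-swap⁺ BPTree-node-swap⁻ F-BR T-BR F-BR⁺ F-BR⁻ t-br T-BR⁻

mutual
  F*RB≗ : ∀ f → RB.F* f ≡ F*RB f
  F*RB≗ [] = refl
  F*RB≗ (t ∷ f) = cong₂ _⊙_ (T*RB≗ t) (F*RB≗ f)

  T*RB≗ : ∀ t → RB.T* t ≡ T*RB t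
  T*RB≗ (Node c fl fr) = cong₂ (λ a b → a ◁R (b ◁B c)) (F*RB≗ fl) (F*RB≗ fr)

IsInverse-cong : {A B : Set} {P : A → Set} {Q : B → Set} {R : A → B → Set} {g h : B → A} →
  (∀ b → g b ≡ h b) → IsInverse P Q R g → IsInverse P Q R h
IsInverse-cong {P = P} {R = R} g≗h (l , r) =
  (λ a b p q → trans (sym (g≗h b)) (l a b p q)) , λ b q → subst (λ a → P a × R a b) (g≗h b) (r b q)

mainTheorem7 : ∀ (n : ℕ) →
    (IsBijection (PW n) (BPF n) F-RB × IsInverse (PW n) (BPF n) F-RB F*RB) ×
    (IsBijection (IrrPW n) (BPT n) T-RB × IsInverse (IrrPW n) (BPT n) T-RB T*RB) ×
    IsBijection (PW n) (BPF n) F-BR ×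
    IsBijection (IrrPW n) (BPT n) T-BR
mainTheorem7 n =
  (RB.F-bijection n , IsInverse-cong F*RB≗ (RB.F-inverse n)) ,
  (RB.T-bijection n , IsInverse-cong T*RB≗ (RB.T-inverse n)) ,
  BR.F-bijection n ,
  BR.T-bijection n
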